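{- Let $\mathsf a=(\mathsf a_{\ell,\ell'})_{\ell,\ell'\ge0}$, $\mathsf b=(\mathsf b_{\ell,\ell'})$, $\mathsf c=(\mathsf c_{\ell,\ell'})$, $\mathsf d=(\mathsf d_{\ell,\ell'})$, $\mathsf e=(\mathsf e_\ell)_{\ell\ge0}$, $\mathsf f=(\mathsf f_\ell)_{\ell\ge0}$ be indeterminates, and for $n\ge0$ define $$Q_n=\sum_{\sigma\in\mathfrak D_{2n}}\prod_{i\in\mathrm{Cval}(\sigma)}\mathsf a_{\mathrm{ucross}(i,\sigma),\mathrm{unest}(i,\sigma)}\prod_{i\in\mathrm{Cpeak}(\sigma)}\mathsf b_{\mathrm{lcross}(i,\sigma),\mathrm{lnest}(i,\sigma)}\prod_{i\in\mathrm{Cdfall}(\sigma)}\mathsf c_{\mathrm{lcross}(i,\sigma),\mathrm{lnest}(i,\sigma)}\prod_{i\in\mathrm{Cdrise}(\sigma)}\mathsf d_{\mathrm{ucross}(i,\sigma),\mathrm{unest}(i,\sigma)}\prod_{i\in\mathrm{Evenfix}(\sigma)}\mathsf e_{\mathrm{psnest}(i,\sigma)}\prod_{i\in\mathrm{Oddfix}(\sigma)}\mathsf f_{\mathrm{psnest}(i,\sigma)}.$$ Then $\sum_{n\ge0}Q_nt^n$ equals the T-type continued fraction with coefficients $\alpha_{2k-1}=\Bigl(\sum_{\xi=0}^{k-1}\mathsf a_{k-1-\xi,\xi}\Bigr)\Bigl(\sum_{\xi=0}^{k-1}\mathsf b_{k-1-\xi,\xi}\Bigr)$, $\alpha_{2k}=\Bigl(\mathsf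 e_k+\sum_{\xi=0}^{k-1}\mathsf c_{k-1-\xi,\xi}\Bigr)\Bigl(\mathsf f_k+\sum_{\xi=0}^{k-1}\mathsf d_{k-1-\xi,\xi}\Bigr)$ for $k\ge1$, $\delta_1=\mathsf e_0\mathsf f_0$, $\delta_n=0$ for $n\ge2$.
   Context: $\mathfrak D_{2n}$ is the set of permutations $\sigma$ of $[2n]$ with $\sigma(2k-1)\ge2k-1$ and $\sigma(2k)\le2k$ for all $k\in[n]$. $\mathrm{Cval}(\sigma)=\{i:\sigma^{ -1}(i)>i<\sigma(i)\}$, $\mathrm{Cpeak}(\sigma)=\{i:\sigma^{ -1}(i)<i>\sigma(i)\}$, $\mathrm{Cdrise}(\sigma)=\{i:\sigma^{ -1}(i)<i<\sigma(i)\}$, $\mathrm{Cdfall}(\sigma)=\{i:\sigma^{ -1}(i)>i>\sigma(i)\}$, $\mathrm{Evenfix}(\sigma)$ and $\mathrm{Oddfix}(\sigma)$ are the sets of even, resp. odd, fixed points. $\mathrm{ucross}(j,\sigma)=\#\{(i,k,l):i<j<k<l,\ k=\sigma(i),\ l=\sigma(j)\}$, $\mathrm{unest}(j,\sigma)=\#\{(i,k,l):i<j<k<l,\ k=\sigma(j),\ l=\sigma(i)\}$, $\mathrm{lcross}(k,\sigma)=\#\{(i,j,l):i<j<k<l,\ i=\sigma(k),\ j=\sigma(l)\}$, $\mathrm{lnest}(k,\sigma)=\#\{(i,j,l):i<j<k<l,\ i=\sigma(l),\ j=\sigma(k)\}$; for a fixed point $j$, $\mathrm{psnest}(j,\sigma)=\#\{i<j:\sigma(i)>j\}$.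 The T-type continued fraction with coefficients $(\alpha_n)_{n\ge1},(\delta_n)_{n\ge1}$ is the formal power series $1/(1-\delta_1t-\alpha_1t/(1-\delta_2t-\alpha_2t/(1-\delta_3t-\cdots)))$. -}

module Defs where

open import Level using (Level)
open import Data.Bool using (Bool; true; false; _∧_; if_then_else_; not)
open import Data.Nat using (ℕ; zero; suc; _∸_; _<ᵇ_; _≡ᵇ_; _≤ᵇ_; ⌊_/2⌋)
import Data.Nat as N
open import Data.List using (List; []; _∷_; map; foldr; length; upTo; filterᵇ; concatMap)
open import Algebra.Bundles using (CommutativeRing)

range : ℕ → List ℕ
range m = map suc (upTo m)

allWords : ℕ → ℕ → List (List ℕ)
allWords m zero    = [] ∷ []
allWords m (suc k) = concatMap (λ x → map (x ∷_) (allWords m k)) (range m)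

allB : {A : Set} → (A → Bool) → List A → Bool
allB p []       = true
allB p (x ∷ xs) = p x ∧ allB p xs

notIn : ℕ → List ℕ → Bool
notIn x ys = allB (λ y → not (x ≡ᵇ y)) ys

allDistinct : List ℕ → Bool
allDistinct []       = true
allDistinct (x ∷ xs) = notIn x xs ∧ allDistinct xs

-- permutations of [m] in one-line notation σ(1) σ(2) … σ(m)
perms : ℕ → List (List ℕ)
perms m = filterᵇ allDistinct (allWords m m)

-- σ(i) for 1 ≤ i ≤ length w  (0 outside the domain)
at : List ℕ → ℕ → ℕ
at []       _             = 0
at (x ∷ xs) zero          = 0
at (x ∷ xs) (suc zero)    = x
at (x ∷ xs) (suc (suc k)) = at xs (suc k)

-- σ⁻¹(i): the j ∈ [1..m] with σ(j) = i (0 if none)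
invAt : ℕ → List ℕ → ℕ → ℕ
invAt m w i = foldr (λ j r → if at w j ≡ᵇ i then j else r) 0 (range m)

isEven : ℕ → Bool
isEven zero          = true
isEven (suc zero)    = false
isEven (suc (suc n)) = isEven n

isD : ℕ → List ℕ → Bool
isD m w = allB (λ i → if isEven i then at w i ≤ᵇ i else i ≤ᵇ at w i) (range m)

Dperms : ℕ → List (List ℕ)
Dperms n = filterᵇ (isD (2 N.* n)) (perms (2 N.* n))

count : ℕ → (ℕ → Bool) → ℕ
count m p = length (filterᵇ p (range m))

module Stats (m : ℕ) (w : List ℕ) where
  σ : ℕ → ℕ
  σ = at w
  σ⁻¹ : ℕ → ℕ
  σ⁻¹ = invAt m w

  isCval isCpeak isCdrise isCdfall isEvenfix isOddfix : ℕ → Bool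
  isCval   i = (i <ᵇ σ⁻¹ i) ∧ (i <ᵇ σ i)
  isCpeak  i = (σ⁻¹ i <ᵇ i) ∧ (σ i <ᵇ i)
  isCdrise i = (σ⁻¹ i <ᵇ i) ∧ (i <ᵇ σ i)
  isCdfall i = (i <ᵇ σ⁻¹ i) ∧ (σ i <ᵇ i)
  isEvenfix i = (σ i ≡ᵇ i) ∧ isEven i
  isOddfix  i = (σ i ≡ᵇ i) ∧ not (isEven i)

  -- ucross(j) = #{(i,k,l) : i<j<k<l, k=σ(i), l=σ(j)}   (the triple is determined by i)
  ucross : ℕ → ℕ
  ucross j = count m (λ i → (i <ᵇ j) ∧ (j <ᵇ σ i) ∧ (σ i <ᵇ σ j))
  -- unest(j) = #{(i,k,l) : i<j<k<l, k=σ(j), l=σ(i)}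
  unest : ℕ → ℕ
  unest j = count m (λ i → (i <ᵇ j) ∧ (j <ᵇ σ j) ∧ (σ j <ᵇ σ i))
  -- lcross(k) = #{(i,j,l) : i<j<k<l, i=σ(k), j=σ(l)}   (determined by l)
  lcross : ℕ → ℕ
  lcross k = count m (λ l → (σ k <ᵇ σ l) ∧ (σ l <ᵇ k) ∧ (k <ᵇ l))
  -- lnest(k) = #{(i,j,l) : i<j<k<l, i=σ(l), j=σ(k)}
  lnest : ℕ → ℕ
  lnest k = count m (λ l → (σ l <ᵇ σ k) ∧ (σ k <ᵇ k) ∧ (k <ᵇ l))
  psnest : ℕ → ℕ
  psnest j = count m (λ i → (i <ᵇ j) ∧ (j <ᵇ σ i))

module _ {c ℓ : Level} (R : CommutativeRing c ℓ) where
  open CommutativeRing R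

  sumR : List Carrier → Carrier
  sumR = foldr _+_ 0#

  prodR : List Carrier → Carrier
  prodR = foldr _*_ 1#

  prodOver : ℕ → (ℕ → Bool) → (ℕ → Carrier) → Carrier
  prodOver m p g = prodR (map g (filterᵇ p (range m)))

  weight : (a b c' d : ℕ → ℕ → Carrier) (e f : ℕ → Carrier) → ℕ → List ℕ → Carrier
  weight a b c' d e f m w =
      prodOver m isCval   (λ i → a  (ucross i) (unest i))
    * (prodOver m isCpeak  (λ i → b  (lcross i) (lnest i))
    * (prodOver m isCdfall (λ i → c' (lcross i) (lnest i))
    * (prodOver m isCdrise (λ i → d  (ucross i) (unest i))
    * (prodOver m isEvenfix (λ i → e (psnest i))
    *  prodOver m isOddfix  (λ i → f (psnest i))))))
    where open Stats m w

  Q : (a b c' d : ℕ → ℕ → Carrier) (e f : ℕ → Carrier) → ℕ → Carrier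
  Q a b c' d e f n = sumR (map (weight a b c' d e f (2 N.* n)) (Dperms n))

  Series : Set c
  Series = ℕ → Carrier

  constS : Carrier → Series
  constS x zero    = x
  constS x (suc _) = 0#

  oneS : Series
  oneS = constS 1#

  tmul : Series → Series
  tmul s zero    = 0#
  tmul s (suc n) = s n

  conv : Series → Series → Series
  conv u v n = sumR (map (λ k → u k * v (n ∸ k)) (upTo (suc n)))

  powS : Series → ℕ → Series
  powS u zero    = oneS
  powS u (suc j) = conv u (powS u j)

  -- 1/(1 - u) for u with zero constant term: Σ_j u^j (u^j has no terms below t^j)
  geomInv : Series → Series
  geomInv u n = sumR (map (λ j → powS u j n) (upTo (suc n)))

  tfrac : (α δ : ℕ → Carrier) → ℕ → ℕ → Series
  tfrac α δ zero    j = oneS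
  tfrac α δ (suc d) j =
    geomInv (tmul (λ n → constS (δ j) n + α j * tfrac α δ d (suc j) n))

  -- coefficient of t^n of the infinite T-fraction
  -- 1/(1-δ₁t-α₁t/(1-δ₂t-α₂t/(1-…))); the depth-(n+1) truncation already
  -- has the correct coefficient of t^n.
  Tcoeff : (α δ : ℕ → Carrier) → ℕ → Carrier
  Tcoeff α δ n = tfrac α δ (suc n) 1 n

  diagSum : (ℕ → ℕ → Carrier) → ℕ → Carrier
  diagSum x k = sumR (map (λ ξ → x (k ∸ 1 ∸ ξ) ξ) (upTo k))

  alphaOdd : (a b : ℕ → ℕ → Carrier) → ℕ → Carrier
  alphaOdd a b k = diagSum a k * diagSum b k

  alphaEven : (c' d : ℕ → ℕ → Carrier) (e f : ℕ → Carrier) → ℕ → Carrier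
  alphaEven c' d e f k = (e k + diagSum c' k) * (f k + diagSum d k)

  -- α_n (n ≥ 1; α_0 is unused)
  alpha : (a b c' d : ℕ → ℕ → Carrier) (e f : ℕ → Carrier) → ℕ → Carrier
  alpha a b c' d e f zero    = 0#
  alpha a b c' d e f (suc m) =
    if isEven m then alphaOdd a b (suc ⌊ m /2⌋) else alphaEven c' d e f (suc ⌊ m /2⌋)

  -- δ₁ = e₀ f₀, δ_n = 0 for n ≥ 2 (δ₀ unused)
  delta : (e f : ℕ → Carrier) → ℕ → Carrier
  delta e f (suc zero) = e 0 * f 0
  delta e f _          = 0#

{-# OPTIONS --safe #-}
module Submission where

open import Defs
open import Level using (Level)
open import Data.Bool using (Bool; true; false; _∧_; _∨_; if_then_else_; not)
import Data.Bool.Properties as 𝔹ₚ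
open import Data.Empty using (⊥-elim)
open import Data.Nat as N using (ℕ; zero; suc; _∸_; _<ᵇ_; _≡ᵇ_; _≤ᵇ_; _≤_; _<_; z≤n; s≤s; s≤s⁻¹; _≤?_; _<?_; _≟_)
import Data.Nat.Properties as ℕₚ
open import Data.Nat.Solver using (module +-*-Solver)
open import Data.List using (List; []; _∷_; length; map; _++_; _ʳ++_; concatMap; applyUpTo; foldr; filterᵇ)
import Data.List.Properties as Listₚ
open import Data.List.Relation.Unary.All as All using (All; []; _∷_)
import Data.List.Relation.Unary.All.Properties as Allₚ
open import Data.Product using (_×_; _,_; proj₁; proj₂)
open import Data.Vec using (Vec; []; _∷_)
open import Relation.Binary.Definitions using (tri<; tri≈; tri>)
open import Relation.Binary.PropositionalEquality as ≡ using (_≡_; _≢_; cong; cong₂)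
open import Relation.Nullary using (yes; no; contradiction)
open import Relation.Nullary.Decidable using (dec-true; dec-false)
open import Function using (_∘_; id)
open import Algebra.Bundles using (CommutativeRing)

-- Scan σ from left to right and, after position j, remember the set S of values > j already used and
-- the number h of values ≤ j not used yet (h = |S| along a permutation).  A letter above the diagonal
-- inserts its value into S, and (ucross, unest) is the rank of that value in S; a letter below the
-- diagonal takes one of the h unused small values, and (lcross, lnest) is the rank of that value.
-- The total weight of the completions depends on S, but summed over all S with |S| = h it does not:
-- ∑_S ∑_{v ∉ S} = ∑_{S′} ∑_{v ∈ S′} turns every insertion into the factor ∑_ξ a_{h−ξ,ξ} (or the same
-- with d), leaving a weighted path in the height h only.  Two consecutive steps of this path are
-- the even contraction of the T-fraction, whose tails J_i satisfy J_i = 1 + t (δ_i + α_i J_{i+1}) J_i.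

-- The two kinds of letters behave differently. Above the diagonal the chosen value changes S, hence
-- all later weights, and nothing comes out for a single S. That is why sets of one size are summed
-- together. Nothing is lost at the start: the empty set is the only one of size 0, so the sum at
-- height 0 is the sum over all words. The coefficients come from pairing an odd position with the
-- next even one. With `A`, `B`, `E`, `F` the weights of up, down, even level and odd level steps, a
-- pair of steps has weight A_{h+1} E_{h+1} from h to h + 1, F_h B_h from h to h - 1, and E_h F_h +
-- A_{h+1} B_{h+1} from h to h. These are the weights of an even contraction exactly when α_{2h-1} =
-- A_h B_h and α_{2h} = E_h F_h. At h = 0 the level term E_0 F_0 has no α to come from, and δ_1
-- supplies it.

-- Words, counting on intervals of values, and the statistics at one position.

module WordCombinatorics where
  open N using (_+_)
  open ≡ using (refl; sym; trans; subst)
  open ≡.≡-Reasoning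

  private variable
    q r : ℕ → Bool

  <ᵇ-true : ∀ {m n} → m < n → (m <ᵇ n) ≡ true
  <ᵇ-true {m} {n} = dec-true (m <? n)

  <ᵇ-false : ∀ {m n} → n ≤ m → (m <ᵇ n) ≡ false
  <ᵇ-false {m} {n} n≤m = dec-false (m <? n) (ℕₚ.≤⇒≯ n≤m)

  ≤ᵇ-true : ∀ {m n} → m ≤ n → (m ≤ᵇ n) ≡ true
  ≤ᵇ-true {m} {n} = dec-true (m ≤? n)

  ≤ᵇ-false : ∀ {m n} → n < m → (m ≤ᵇ n) ≡ false
  ≤ᵇ-false {m} {n} n<m = dec-false (m ≤? n) (ℕₚ.<⇒≱ n<m)

  ≡ᵇ-refl : ∀ n → (n ≡ᵇ n) ≡ true
  ≡ᵇ-refl n = dec-true (n ≟ n) refl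

  ≡ᵇ-false : ∀ {m n} → m ≢ n → (m ≡ᵇ n) ≡ false
  ≡ᵇ-false {m} {n} = dec-false (m ≟ n)

  ≡ᵇ-sym : ∀ m n → (m ≡ᵇ n) ≡ (n ≡ᵇ m)
  ≡ᵇ-sym zero    zero    = refl
  ≡ᵇ-sym zero    (suc n) = refl
  ≡ᵇ-sym (suc m) zero    = refl
  ≡ᵇ-sym (suc m) (suc n) = ≡ᵇ-sym m n

  ∧-trueˡ : ∀ {x y} → x ∧ y ≡ true → x ≡ true
  ∧-trueˡ {true} _ = refl

  ∧-trueʳ : ∀ {x y} → x ∧ y ≡ true → y ≡ true
  ∧-trueʳ {true} eq = eq

  bit : Bool → ℕ
  bit true  = 1
  bit false = 0

  -- The number of v with o < v ≤ o + k and q v.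
  countFrom : ℕ → ℕ → (ℕ → Bool) → ℕ
  countFrom o zero    q = 0
  countFrom o (suc k) q = bit (q (suc o)) + countFrom (suc o) k q

  countFrom-cong : ∀ o k → (∀ v → o < v → v ≤ o + k → q v ≡ r v) → countFrom o k q ≡ countFrom o k r
  countFrom-cong o zero    eq = refl
  countFrom-cong o (suc k) eq = cong₂ _+_
    (cong bit (eq (suc o) ℕₚ.≤-refl (ℕₚ.≤-trans (s≤s (ℕₚ.m≤m+n o k)) (ℕₚ.≤-reflexive (sym (ℕₚ.+-suc o k))))))
    (countFrom-cong (suc o) k λ v o<v v≤o+k →
      eq v (ℕₚ.<⇒≤ o<v) (ℕₚ.≤-trans v≤o+k (ℕₚ.≤-reflexive (sym (ℕₚ.+-suc o k)))))

  countFrom-false : ∀ o k → countFrom o k (λ _ → false) ≡ 0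
  countFrom-false o zero    = refl
  countFrom-false o (suc k) = countFrom-false (suc o) k

  countFrom-split : ∀ o k l q → countFrom o (k + l) q ≡ countFrom o k q + countFrom (o + k) l q
  countFrom-split o zero    l q = cong (λ n → countFrom n l q) (sym (ℕₚ.+-identityʳ o))
  countFrom-split o (suc k) l q = begin
    bit (q (suc o)) + countFrom (suc o) (k + l) q
      ≡⟨ cong (bit (q (suc o)) +_) (countFrom-split (suc o) k l q) ⟩
    bit (q (suc o)) + (countFrom (suc o) k q + countFrom (suc o + k) l q)
      ≡⟨ ℕₚ.+-assoc (bit (q (suc o))) _ _ ⟨
    bit (q (suc o)) + countFrom (suc o) k q + countFrom (suc o + k) l q
      ≡⟨ cong (λ n → bit (q (suc o)) + countFrom (suc o) k q + countFrom n l q) (ℕₚ.+-suc o k) ⟨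
    bit (q (suc o)) + countFrom (suc o) k q + countFrom (o + suc k) l q ∎

  countFrom-≤ : ∀ o k q → countFrom o k q ≤ k
  countFrom-≤ o zero    q = z≤n
  countFrom-≤ o (suc k) q with q (suc o)
  ... | true  = s≤s (countFrom-≤ (suc o) k q)
  ... | false = ℕₚ.m≤n⇒m≤1+n (countFrom-≤ (suc o) k q)

  -- Each of the `k` candidates adds at most one, so a single miss would push the count below `k`.
  -- This is the pigeonhole principle behind `distinct-full`.
  countFrom-full : ∀ o k q → countFrom o k q ≡ k → ∀ v → o < v → v ≤ o + k → q v ≡ true
  countFrom-full o zero    q eq v o<v v≤o+k =
    contradiction (ℕₚ.≤-trans v≤o+k (ℕₚ.≤-reflexive (ℕₚ.+-identityʳ o))) (ℕₚ.<⇒≱ o<v)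
  countFrom-full o (suc k) q eq v o<v v≤o+k with q (suc o) in head
  ... | false = contradiction (countFrom-≤ (suc o) k q) (ℕₚ.<⇒≱ (ℕₚ.≤-reflexive (sym eq)))
  ... | true with v ≟ suc o
  ...   | yes refl = head
  ...   | no  v≢   = countFrom-full (suc o) k q (ℕₚ.suc-injective eq) v
                       (ℕₚ.≤∧≢⇒< o<v (v≢ ∘ sym)) (ℕₚ.≤-trans v≤o+k (ℕₚ.≤-reflexive (ℕₚ.+-suc o k)))

  -- Cuts a statistic that counts over all values down to the interval where its inequalities can
  -- hold; `r` is what remains of the predicate once they are known to hold.
  countFrom-window : ∀ {lo hi m} → lo ≤ hi → hi ≤ m →
    (∀ v → v ≤ lo → q v ≡ false) →
    (∀ v → lo < v → v ≤ hi → q v ≡ r v) →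
    (∀ v → hi < v → v ≤ m → q v ≡ false) →
    countFrom 0 m q ≡ countFrom lo (hi ∸ lo) r
  countFrom-window {q = q} {r = r} {lo} {hi} {m} lo≤hi hi≤m below inside above = begin
    countFrom 0 m q
      ≡⟨ cong (λ n → countFrom 0 n q) (ℕₚ.m+[n∸m]≡n hi≤m) ⟨
    countFrom 0 (hi + (m ∸ hi)) q
      ≡⟨ countFrom-split 0 hi (m ∸ hi) q ⟩
    countFrom 0 hi q + countFrom hi (m ∸ hi) q
      ≡⟨ cong (countFrom 0 hi q +_) (trans
           (countFrom-cong hi (m ∸ hi) (λ v hi<v v≤ → above v hi<v (subst (v ≤_) (ℕₚ.m+[n∸m]≡n hi≤m) v≤)))
           (countFrom-false hi (m ∸ hi))) ⟩
    countFrom 0 hi q + 0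
      ≡⟨ ℕₚ.+-identityʳ _ ⟩
    countFrom 0 hi q
      ≡⟨ cong (λ n → countFrom 0 n q) (ℕₚ.m+[n∸m]≡n lo≤hi) ⟨
    countFrom 0 (lo + (hi ∸ lo)) q
      ≡⟨ countFrom-split 0 lo (hi ∸ lo) q ⟩
    countFrom 0 lo q + countFrom lo (hi ∸ lo) q
      ≡⟨ cong₂ _+_
           (trans (countFrom-cong 0 lo (λ v _ v≤lo → below v v≤lo)) (countFrom-false 0 lo))
           (countFrom-cong lo (hi ∸ lo) λ v lo<v v≤ → inside v lo<v (subst (v ≤_) (ℕₚ.m+[n∸m]≡n lo≤hi) v≤)) ⟩
    countFrom lo (hi ∸ lo) r ∎

  -- `r x` stays arbitrary because `count-members` also inserts letters that fail the predicate
  -- being counted.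
  countFrom-insert : ∀ {m x} → 0 < x → x ≤ m → q x ≡ false → (∀ v → v ≢ x → r v ≡ q v) →
                     countFrom 0 m r ≡ bit (r x) + countFrom 0 m q
  countFrom-insert {q = q} {r = r} {m} {suc t} _ t<m qx≡false eq = begin
    countFrom 0 m r
      ≡⟨ split r ⟩
    countFrom 0 t r + (bit (r (suc t)) + countFrom (suc t) (m ∸ suc t) r)
      ≡⟨ cong₂ (λ y z → y + (bit (r (suc t)) + z))
           (countFrom-cong 0 t λ v _ v≤t → eq v (ℕₚ.<⇒≢ (s≤s v≤t)))
           (countFrom-cong (suc t) (m ∸ suc t) λ v t<v _ → eq v (ℕₚ.>⇒≢ t<v)) ⟩
    countFrom 0 t q + (bit (r (suc t)) + countFrom (suc t) (m ∸ suc t) q)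
      ≡⟨ solve 3 (λ a b c → a :+ (b :+ c) := b :+ (a :+ c)) refl (countFrom 0 t q) (bit (r (suc t))) _ ⟩
    bit (r (suc t)) + (countFrom 0 t q + countFrom (suc t) (m ∸ suc t) q)
      ≡⟨ cong (λ b → bit (r (suc t)) + (countFrom 0 t q + (bit b + countFrom (suc t) (m ∸ suc t) q))) qx≡false ⟨
    bit (r (suc t)) + (countFrom 0 t q + (bit (q (suc t)) + countFrom (suc t) (m ∸ suc t) q))
      ≡⟨ cong (bit (r (suc t)) +_) (split q) ⟨
    bit (r (suc t)) + countFrom 0 m q ∎
    where
    open import Data.Nat.Solver using (module +-*-Solver)
    open +-*-Solver using (solve; _:=_; _:+_)
    split : ∀ q → countFrom 0 m q ≡ countFrom 0 t q + (bit (q (suc t)) + countFrom (suc t) (m ∸ suc t) q)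
    split q = trans (cong (λ n → countFrom 0 n q)
                          (sym (trans (ℕₚ.+-suc t (m ∸ suc t)) (ℕₚ.m+[n∸m]≡n t<m))))
                    (countFrom-split 0 t (suc (m ∸ suc t)) q)

  -- Recursion on a suffix that carries the absolute position. The definitions enumerate indices and
  -- look letters up with `at`; recast as this fold they admit induction on the word.
  posFold : ∀ {ℓ} {B : Set ℓ} → (ℕ → ℕ → B → B) → ℕ → B → List ℕ → B
  posFold g o z []      = z
  posFold g o z (x ∷ s) = g (suc o) x (posFold g (suc o) z s)

  foldr-range : ∀ {ℓ} {B : Set ℓ} (g : ℕ → ℕ → B → B) z w →
                foldr (λ j → g j (at w j)) z (range (length w)) ≡ posFold g 0 z w
  foldr-range g z w = go w 0 id (λ _ → refl) (λ _ → refl)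
    where
    -- `applyUpTo` unfolds by composing its function with `suc`, so the induction needs an `f` that
    -- is known only pointwise to be the shift by `o`.
    go : ∀ s o f → (∀ t → f t ≡ o + t) → (∀ t → at w (suc (f t)) ≡ at s (suc t)) →
         foldr (λ j → g j (at w j)) z (map suc (applyUpTo f (length s))) ≡ posFold g o z s
    go []      o f f≡ at≡ = refl
    go (x ∷ s) o f f≡ at≡ = begin
      g (suc (f 0)) (at w (suc (f 0))) rest
        ≡⟨ cong₂ (λ i y → g (suc i) y rest) (trans (f≡ 0) (ℕₚ.+-identityʳ o)) (at≡ 0) ⟩
      g (suc o) x rest
        ≡⟨ cong (g (suc o) x) (go s (suc o) (f ∘ suc) (λ t → trans (f≡ (suc t)) (ℕₚ.+-suc o t)) (at≡ ∘ suc)) ⟩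
      g (suc o) x (posFold g (suc o) z s) ∎
      where rest = foldr (λ j → g j (at w j)) z (map suc (applyUpTo (f ∘ suc) (length s)))

  length-filterᵇ-∷ : ∀ (p : ℕ → Bool) x xs →
                     length (filterᵇ p (x ∷ xs)) ≡ bit (p x) + length (filterᵇ p xs)
  length-filterᵇ-∷ p x xs with p x
  ... | true  = refl
  ... | false = refl

  length-filterᵇ : ∀ (p : ℕ → Bool) xs → length (filterᵇ p xs) ≡ foldr (λ x n → bit (p x) + n) 0 xs
  length-filterᵇ p []       = refl
  length-filterᵇ p (x ∷ xs) = trans (length-filterᵇ-∷ p x xs) (cong (bit (p x) +_) (length-filterᵇ p xs))

  posCount : (ℕ → ℕ → Bool) → ℕ → List ℕ → ℕ
  posCount P o = posFold (λ i x n → bit (P i x) + n) o 0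

  count-posCount : ∀ (P : ℕ → ℕ → Bool) w → count (length w) (λ i → P i (at w i)) ≡ posCount P 0 w
  count-posCount P w = trans (length-filterᵇ _ (range (length w))) (foldr-range (λ i x n → bit (P i x) + n) 0 w)

  posCount-none : ∀ (P : ℕ → ℕ → Bool) o s → (∀ i x → o < i → P i x ≡ false) → posCount P o s ≡ 0
  posCount-none P o []      P≡ = refl
  posCount-none P o (x ∷ s) P≡ = cong₂ _+_ (cong bit (P≡ (suc o) x ℕₚ.≤-refl))
    (posCount-none P (suc o) s λ i y o<i → P≡ i y (ℕₚ.<⇒≤ o<i))

  posCount-suffix : ∀ (P : ℕ → ℕ → Bool) Q o s → (∀ i x → o < i → P i x ≡ Q x) →
                    posCount P o s ≡ length (filterᵇ Q s)
  posCount-suffix P Q o []      P≡ = refl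
  posCount-suffix P Q o (x ∷ s) P≡ = trans
    (cong₂ _+_ (cong bit (P≡ (suc o) x ℕₚ.≤-refl))
               (posCount-suffix P Q (suc o) s λ i y o<i → P≡ i y (ℕₚ.<⇒≤ o<i)))
    (sym (length-filterᵇ-∷ Q x s))

  -- `p ʳ++ x ∷ s` and `(x ∷ p) ʳ++ s` are the same word by computation: reading a letter lengthens
  -- the reversed prefix and leaves the word fixed. This lets a prefix be peeled without any
  -- transport.
  posCount-ʳ++ : ∀ (P : ℕ → ℕ → Bool) Q p s → (∀ i x → i ≤ length p → P i x ≡ Q x) →
                 posCount P 0 (p ʳ++ s) ≡ length (filterᵇ Q p) + posCount P (length p) s
  posCount-ʳ++ P Q []      s P≡ = refl
  posCount-ʳ++ P Q (y ∷ p) s P≡ = begin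
    posCount P 0 (p ʳ++ y ∷ s)
      ≡⟨ posCount-ʳ++ P Q p (y ∷ s) (λ i x i≤ → P≡ i x (ℕₚ.m≤n⇒m≤1+n i≤)) ⟩
    length (filterᵇ Q p) + (bit (P (suc (length p)) y) + rest)
      ≡⟨ cong (λ b → length (filterᵇ Q p) + (bit b + rest)) (P≡ (suc (length p)) y ℕₚ.≤-refl) ⟩
    length (filterᵇ Q p) + (bit (Q y) + rest)
      ≡⟨ ℕₚ.+-assoc (length (filterᵇ Q p)) (bit (Q y)) rest ⟨
    length (filterᵇ Q p) + bit (Q y) + rest
      ≡⟨ cong (_+ rest) (trans (ℕₚ.+-comm (length (filterᵇ Q p)) (bit (Q y))) (sym (length-filterᵇ-∷ Q y p))) ⟩
    length (filterᵇ Q (y ∷ p)) + rest ∎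
    where rest = posCount P (suc (length p)) s

  posCount-prefix : ∀ (P : ℕ → ℕ → Bool) Q p s →
    (∀ i x → i ≤ length p → P i x ≡ Q x) → (∀ i x → length p < i → P i x ≡ false) →
    posCount P 0 (p ʳ++ s) ≡ length (filterᵇ Q p)
  posCount-prefix P Q p s P≡Q P≡false = trans (posCount-ʳ++ P Q p s P≡Q)
    (trans (cong (length (filterᵇ Q p) +_) (posCount-none P (length p) s P≡false)) (ℕₚ.+-identityʳ _))

  posCount-after : ∀ (P : ℕ → ℕ → Bool) Q p s →
    (∀ i x → i ≤ length p → P i x ≡ false) → (∀ i x → length p < i → P i x ≡ Q x) →
    posCount P 0 (p ʳ++ s) ≡ length (filterᵇ Q s)
  posCount-after P Q p s P≡false P≡Q = trans (posCount-ʳ++ P (λ _ → false) p s P≡false)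
    (cong₂ _+_ (none p) (posCount-suffix P Q (length p) s P≡Q))
    where
    none : ∀ p → length (filterᵇ (λ _ → false) p) ≡ 0
    none []      = refl
    none (_ ∷ p) = none p

  at-ʳ++ : ∀ p s t → at (p ʳ++ s) (suc (length p + t)) ≡ at s (suc t)
  at-ʳ++ []      s t = refl
  at-ʳ++ (y ∷ p) s t = trans (cong (at (p ʳ++ y ∷ s) ∘ suc) (sym (ℕₚ.+-suc (length p) t))) (at-ʳ++ p (y ∷ s) (suc t))

  notIn-ʳ++ : ∀ v p s → notIn v (p ʳ++ s) ≡ notIn v p ∧ notIn v s
  notIn-ʳ++ v []      s = refl
  notIn-ʳ++ v (y ∷ p) s = begin
    notIn v (p ʳ++ y ∷ s)                       ≡⟨ notIn-ʳ++ v p (y ∷ s) ⟩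
    notIn v p ∧ (not (v ≡ᵇ y) ∧ notIn v s)      ≡⟨ 𝔹ₚ.∧-assoc (notIn v p) _ _ ⟨
    (notIn v p ∧ not (v ≡ᵇ y)) ∧ notIn v s      ≡⟨ cong (_∧ notIn v s) (𝔹ₚ.∧-comm (notIn v p) _) ⟩
    (not (v ≡ᵇ y) ∧ notIn v p) ∧ notIn v s      ∎

  disjoint : List ℕ → List ℕ → Bool
  disjoint p s = allB (λ y → notIn y s) p

  disjoint-[] : ∀ p → disjoint p [] ≡ true
  disjoint-[] []      = refl
  disjoint-[] (_ ∷ p) = disjoint-[] p

  disjoint-∷ : ∀ p y s → disjoint p (y ∷ s) ≡ notIn y p ∧ disjoint p s
  disjoint-∷ []      y s = refl
  disjoint-∷ (x ∷ p) y s = trans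
    (cong₂ (λ b c → (not b ∧ notIn x s) ∧ c) (≡ᵇ-sym x y) (disjoint-∷ p y s))
    (swap (not (y ≡ᵇ x)) (notIn x s) (notIn y p) (disjoint p s))
    where
    swap : ∀ a b c d → (a ∧ b) ∧ (c ∧ d) ≡ (a ∧ c) ∧ (b ∧ d)
    swap false b c d = refl
    swap true  true  c d = refl
    swap true  false c d = sym (𝔹ₚ.∧-zeroʳ c)

  allDistinct-ʳ++ : ∀ p s → allDistinct (p ʳ++ s) ≡ allDistinct p ∧ (disjoint p s ∧ allDistinct s)
  allDistinct-ʳ++ []      s = refl
  allDistinct-ʳ++ (y ∷ p) s = begin
    allDistinct (p ʳ++ y ∷ s)
      ≡⟨ allDistinct-ʳ++ p (y ∷ s) ⟩
    allDistinct p ∧ (disjoint p (y ∷ s) ∧ (notIn y s ∧ allDistinct s))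
      ≡⟨ cong (λ b → allDistinct p ∧ (b ∧ (notIn y s ∧ allDistinct s))) (disjoint-∷ p y s) ⟩
    allDistinct p ∧ ((notIn y p ∧ disjoint p s) ∧ (notIn y s ∧ allDistinct s))
      ≡⟨ shuffle (allDistinct p) (notIn y p) (disjoint p s) (notIn y s) (allDistinct s) ⟩
    (notIn y p ∧ allDistinct p) ∧ ((notIn y s ∧ disjoint p s) ∧ allDistinct s) ∎
    where
    shuffle : ∀ a b c d e → a ∧ ((b ∧ c) ∧ (d ∧ e)) ≡ (b ∧ a) ∧ ((d ∧ c) ∧ e)
    shuffle false b     c     d e = cong (_∧ ((d ∧ c) ∧ e)) (sym (𝔹ₚ.∧-zeroʳ b))
    shuffle true  false c     d e = refl
    shuffle true  true  true  d e = cong (_∧ e) (sym (𝔹ₚ.∧-identityʳ d))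
    shuffle true  true  false d e = cong (_∧ e) (sym (𝔹ₚ.∧-zeroʳ d))

  disjoint-notIn : ∀ v p s → disjoint p s ≡ true → notIn v p ≡ false → notIn v s ≡ true
  disjoint-notIn v (y ∷ p) s dis v∈ with v ≟ y
  ... | yes refl = ∧-trueˡ dis
  ... | no  v≢y  = disjoint-notIn v p s (∧-trueʳ dis)
                     (trans (cong (λ b → not b ∧ notIn v p) (sym (≡ᵇ-false v≢y))) v∈)

  -- Distinctness tested one letter at a time against the prefix, the form in which a scan can
  -- reject a letter when it is read.
  freshAfter : List ℕ → List ℕ → Bool
  freshAfter p []      = true
  freshAfter p (x ∷ s) = notIn x p ∧ freshAfter (x ∷ p) s

  allDistinct-freshAfter : ∀ p s → allDistinct (p ʳ++ s) ≡ allDistinct p ∧ freshAfter p s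
  allDistinct-freshAfter p []      = trans (allDistinct-ʳ++ p []) (cong (λ b → allDistinct p ∧ (b ∧ true)) (disjoint-[] p))
  allDistinct-freshAfter p (x ∷ s) = begin
    allDistinct (p ʳ++ x ∷ s)                                  ≡⟨ allDistinct-freshAfter (x ∷ p) s ⟩
    (notIn x p ∧ allDistinct p) ∧ freshAfter (x ∷ p) s         ≡⟨ cong (_∧ freshAfter (x ∷ p) s) (𝔹ₚ.∧-comm (notIn x p) _) ⟩
    (allDistinct p ∧ notIn x p) ∧ freshAfter (x ∷ p) s         ≡⟨ 𝔹ₚ.∧-assoc (allDistinct p) _ _ ⟩
    allDistinct p ∧ (notIn x p ∧ freshAfter (x ∷ p) s)         ∎

  allowed : ℕ → ℕ → Bool
  allowed i x = if isEven i then x ≤ᵇ i else i ≤ᵇ x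

  allAllowed : ℕ → List ℕ → Bool
  allAllowed o = posFold (λ i x b → allowed i x ∧ b) o true

  isD-allAllowed : ∀ w → isD (length w) w ≡ allAllowed 0 w
  isD-allAllowed w = trans (allB-foldr (range (length w))) (foldr-range (λ i x b → allowed i x ∧ b) true w)
    where
    allB-foldr : ∀ {p : ℕ → Bool} xs → allB p xs ≡ foldr (λ x b → p x ∧ b) true xs
    allB-foldr []       = refl
    allB-foldr (x ∷ xs) = cong (_ ∧_) (allB-foldr xs)

  firstIndex : ℕ → ℕ → List ℕ → ℕ
  firstIndex v o = posFold (λ j x r → if x ≡ᵇ v then j else r) o 0

  invAt-firstIndex : ∀ w v → invAt (length w) w v ≡ firstIndex v 0 w
  invAt-firstIndex w v = foldr-range (λ j x r → if x ≡ᵇ v then j else r) 0 w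

  firstIndex-skip : ∀ v p s → notIn v p ≡ true → firstIndex v 0 (p ʳ++ s) ≡ firstIndex v (length p) s
  firstIndex-skip v []      s _  = refl
  firstIndex-skip v (y ∷ p) s v∉ with v ≡ᵇ y in v≡y
  ... | false = trans (firstIndex-skip v p (y ∷ s) v∉)
                      (cong (λ b → if b then suc (length p) else firstIndex v (suc (length p)) s)
                            (trans (≡ᵇ-sym y v) v≡y))

  firstIndex-≤ : ∀ v p s → notIn v p ≡ false → firstIndex v 0 (p ʳ++ s) ≤ length p
  firstIndex-≤ v (y ∷ p) s v∈ with notIn v p in eq
  ... | false = ℕₚ.m≤n⇒m≤1+n (firstIndex-≤ v p (y ∷ s) eq)
  ... | true with v ≡ᵇ y in v≡y
  ...   | true  = ℕₚ.≤-reflexive (trans (firstIndex-skip v p (y ∷ s) eq)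
                    (cong (λ b → if b then suc (length p) else firstIndex v (suc (length p)) s)
                          (trans (≡ᵇ-sym y v) v≡y)))

  firstIndex-> : ∀ v o s → notIn v s ≡ false → o < firstIndex v o s
  firstIndex-> v o (x ∷ s) v∈ with v ≡ᵇ x in v≡x
  ... | true  rewrite ≡ᵇ-sym x v | v≡x = ℕₚ.≤-refl
  ... | false rewrite ≡ᵇ-sym x v | v≡x = ℕₚ.<-trans (ℕₚ.n<1+n o) (firstIndex-> v (suc o) s v∈)

  Within : ℕ → ℕ → Set
  Within m x = 0 < x × x ≤ m

  used : List ℕ → ℕ → Bool
  used p v = not (notIn v p)

  -- Distinct letters correspond one to one to the values they take. This turns statistics defined
  -- by counting positions into ranks inside a set of values.
  count-members : ∀ {m} (P : ℕ → Bool) p → All (Within m) p → allDistinct p ≡ true →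
                  length (filterᵇ P p) ≡ countFrom 0 m (λ v → P v ∧ used p v)
  count-members {m} P []      _ _ = sym (trans (countFrom-cong 0 m λ v _ _ → 𝔹ₚ.∧-zeroʳ (P v)) (countFrom-false 0 m))
  count-members {m} P (x ∷ p) ((0<x , x≤m) ∷ within) distinct = begin
    length (filterᵇ P (x ∷ p))
      ≡⟨ length-filterᵇ-∷ P x p ⟩
    bit (P x) + length (filterᵇ P p)
      ≡⟨ cong₂ (λ b n → bit b + n)
           (trans (sym (𝔹ₚ.∧-identityʳ (P x))) (cong (λ b → P x ∧ not (not b ∧ notIn x p)) (sym (≡ᵇ-refl x))))
           (count-members P p within (∧-trueʳ distinct)) ⟩
    bit (P x ∧ used (x ∷ p) x) + countFrom 0 m (λ v → P v ∧ used p v)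
      ≡⟨ countFrom-insert 0<x x≤m
           (trans (cong (λ b → P x ∧ not b) (∧-trueˡ distinct)) (𝔹ₚ.∧-zeroʳ (P x)))
           (λ v v≢x → cong (λ b → P v ∧ not (not b ∧ notIn v p)) (≡ᵇ-false v≢x)) ⟨
    countFrom 0 m (λ v → P v ∧ used (x ∷ p) v) ∎

  -- By `count-members` the used values number `length w` among equally many candidates, so none is
  -- missed.
  distinct-full : ∀ w → All (Within (length w)) w → allDistinct w ≡ true →
                  ∀ v → Within (length w) v → notIn v w ≡ false
  distinct-full w within distinct v (0<v , v≤m) = 𝔹ₚ.not-injective
    (countFrom-full 0 (length w) (used w)
      (trans (sym (count-members (λ _ → true) w within distinct)) (all-true w)) v 0<v v≤m)
    where
    all-true : ∀ w → length (filterᵇ (λ _ → true) w) ≡ length w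
    all-true []      = refl
    all-true (_ ∷ w) = cong suc (all-true w)

  All-ʳ++⁻ : ∀ {P : ℕ → Set} p {s} → All P (p ʳ++ s) → All P p × All P s
  All-ʳ++⁻ []      all = [] , all
  All-ʳ++⁻ (y ∷ p) all with All-ʳ++⁻ p all
  ... | all-p , (py ∷ all-s) = py ∷ all-p , all-s

  module Position (p : List ℕ) (x : ℕ) (s : List ℕ)
    (within : All (Within (length (p ʳ++ x ∷ s))) (p ʳ++ x ∷ s))
    (distinct : allDistinct (p ʳ++ x ∷ s) ≡ true)
    where

    w : List ℕ
    w = p ʳ++ x ∷ s

    m j i : ℕ
    m = length w
    j = length p
    i = suc j

    open Stats m w

    σi≡x : σ i ≡ x
    σi≡x = trans (cong (at w ∘ suc) (sym (ℕₚ.+-identityʳ j))) (at-ʳ++ p (x ∷ s) 0)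

    within-p : All (Within m) p
    within-p = proj₁ (All-ʳ++⁻ p within)

    within-x : Within m x
    within-x with proj₂ (All-ʳ++⁻ p within)
    ... | wx ∷ _ = wx

    within-s : All (Within m) s
    within-s with proj₂ (All-ʳ++⁻ p within)
    ... | _ ∷ ws = ws

    parts : allDistinct p ∧ (disjoint p (x ∷ s) ∧ (notIn x s ∧ allDistinct s)) ≡ true
    parts = trans (sym (allDistinct-ʳ++ p (x ∷ s))) distinct

    distinct-p : allDistinct p ≡ true
    distinct-p = ∧-trueˡ parts

    disjoint-ps : disjoint p (x ∷ s) ≡ true
    disjoint-ps = ∧-trueˡ (∧-trueʳ {allDistinct p} parts)

    distinct-s : allDistinct s ≡ true
    distinct-s = ∧-trueʳ {notIn x s} (∧-trueʳ {disjoint p (x ∷ s)} (∧-trueʳ {allDistinct p} parts))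

    i≤m : i ≤ m
    i≤m = subst (i ≤_) (sym (trans (Listₚ.length-ʳ++ p) (ℕₚ.+-suc j (length s)))) (s≤s (ℕₚ.m≤m+n j (length s)))

    -- A permutation takes each value once, so a value other than `x` lies in exactly one of prefix
    -- and suffix. Hence `lcross` and `lnest`, which look at later letters, can be read off the
    -- prefix.
    used-s : ∀ v → Within m v → v ≢ x → used s v ≡ notIn v p
    used-s v wv v≢x with notIn v p in v∈p | notIn v s in v∈s
    ... | true  | false = refl
    ... | false | true  = refl
    ... | true  | true  = trans (sym (distinct-full w within distinct v wv)) absurd
      where
      absurd : notIn v w ≡ true
      absurd = trans (notIn-ʳ++ v p (x ∷ s)) (cong₂ _∧_ v∈p (cong₂ (λ b c → not b ∧ c) (≡ᵇ-false v≢x) v∈s))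
    ... | false | false = trans (sym (∧-trueʳ {not (v ≡ᵇ x)} (disjoint-notIn v p (x ∷ s) disjoint-ps v∈p))) v∈s

    prefix-count : ∀ (P : ℕ → ℕ → Bool) Q →
      (∀ k y → k ≤ j → P k y ≡ Q y) → (∀ k y → j < k → P k y ≡ false) →
      count m (λ k → P k (σ k)) ≡ countFrom 0 m (λ v → Q v ∧ used p v)
    prefix-count P Q P≡Q P≡false = begin
      count m (λ k → P k (σ k))            ≡⟨ count-posCount P w ⟩
      posCount P 0 w                       ≡⟨ posCount-prefix P Q p (x ∷ s) P≡Q P≡false ⟩
      length (filterᵇ Q p)                 ≡⟨ count-members Q p within-p distinct-p ⟩
      countFrom 0 m (λ v → Q v ∧ used p v) ∎

    suffix-count : ∀ (P : ℕ → ℕ → Bool) Q →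
      (∀ k y → k ≤ i → P k y ≡ false) → (∀ k y → i < k → P k y ≡ Q y) →
      count m (λ k → P k (σ k)) ≡ countFrom 0 m (λ v → Q v ∧ used s v)
    suffix-count P Q P≡false P≡Q = begin
      count m (λ k → P k (σ k))            ≡⟨ count-posCount P w ⟩
      posCount P 0 w                       ≡⟨ posCount-after P Q (x ∷ p) s P≡false P≡Q ⟩
      length (filterᵇ Q s)                 ≡⟨ count-members Q s within-s distinct-s ⟩
      countFrom 0 m (λ v → Q v ∧ used s v) ∎

    ucross-i : i < x → ucross i ≡ countFrom i (x ∸ suc i) (used p)
    ucross-i i<x@(s≤s i≤x′) = trans
      (prefix-count (λ k y → (k <ᵇ i) ∧ (i <ᵇ y) ∧ (y <ᵇ σ i)) (λ y → (i <ᵇ y) ∧ (y <ᵇ σ i))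
        (λ k y k≤j → cong (_∧ ((i <ᵇ y) ∧ (y <ᵇ σ i))) (<ᵇ-true (s≤s k≤j)))
        (λ k y j<k → cong (_∧ ((i <ᵇ y) ∧ (y <ᵇ σ i))) (<ᵇ-false j<k)))
      (countFrom-window i≤x′ (ℕₚ.≤-trans (ℕₚ.n≤1+n _) (proj₂ within-x))
        (λ v v≤i → cong (λ b → (b ∧ (v <ᵇ σ i)) ∧ used p v) (<ᵇ-false v≤i))
        (λ v i<v v≤x′ → cong₂ (λ b c → (b ∧ c) ∧ used p v) (<ᵇ-true i<v)
                          (trans (cong (v <ᵇ_) σi≡x) (<ᵇ-true (s≤s v≤x′))))
        (λ v x′<v _ → cong (_∧ used p v) (trans (cong ((i <ᵇ v) ∧_) (trans (cong (v <ᵇ_) σi≡x) (<ᵇ-false x′<v)))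
                                                (𝔹ₚ.∧-zeroʳ (i <ᵇ v)))))

    unest-i : i < x → unest i ≡ countFrom x (m ∸ x) (used p)
    unest-i i<x = trans
      (prefix-count (λ k y → (k <ᵇ i) ∧ (i <ᵇ σ i) ∧ (σ i <ᵇ y)) (λ y → (i <ᵇ σ i) ∧ (σ i <ᵇ y))
        (λ k y k≤j → cong (_∧ ((i <ᵇ σ i) ∧ (σ i <ᵇ y))) (<ᵇ-true (s≤s k≤j)))
        (λ k y j<k → cong (_∧ ((i <ᵇ σ i) ∧ (σ i <ᵇ y))) (<ᵇ-false j<k)))
      (countFrom-window (proj₂ within-x) ℕₚ.≤-refl
        (λ v v≤x → cong (_∧ used p v) (trans (cong ((i <ᵇ σ i) ∧_) (trans (cong (_<ᵇ v) σi≡x) (<ᵇ-false v≤x)))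
                                             (𝔹ₚ.∧-zeroʳ (i <ᵇ σ i))))
        (λ v x<v _ → cong₂ (λ b c → (b ∧ c) ∧ used p v)
                       (trans (cong (i <ᵇ_) σi≡x) (<ᵇ-true i<x)) (trans (cong (_<ᵇ v) σi≡x) (<ᵇ-true x<v)))
        (λ v m<v v≤m → ⊥-elim (ℕₚ.<⇒≱ m<v v≤m)))

    psnest-i : psnest i ≡ countFrom i (m ∸ i) (used p)
    psnest-i = trans
      (prefix-count (λ k y → (k <ᵇ i) ∧ (i <ᵇ y)) (λ y → i <ᵇ y)
        (λ k y k≤j → cong (_∧ (i <ᵇ y)) (<ᵇ-true (s≤s k≤j)))
        (λ k y j<k → cong (_∧ (i <ᵇ y)) (<ᵇ-false j<k)))
      (countFrom-window i≤m ℕₚ.≤-refl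
        (λ v v≤i → cong (_∧ used p v) (<ᵇ-false v≤i))
        (λ v i<v _ → cong (_∧ used p v) (<ᵇ-true i<v))
        (λ v m<v v≤m → ⊥-elim (ℕₚ.<⇒≱ m<v v≤m)))

    lcross-i : x < i → lcross i ≡ countFrom x (j ∸ x) (λ v → notIn v p)
    lcross-i (s≤s x≤j) = trans
      (suffix-count (λ k y → (σ i <ᵇ y) ∧ (y <ᵇ i) ∧ (i <ᵇ k)) (λ y → (σ i <ᵇ y) ∧ (y <ᵇ i))
        (λ k y k≤i → trans (cong (λ b → (σ i <ᵇ y) ∧ (y <ᵇ i) ∧ b) (<ᵇ-false k≤i))
                           (trans (cong ((σ i <ᵇ y) ∧_) (𝔹ₚ.∧-zeroʳ _)) (𝔹ₚ.∧-zeroʳ _)))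
        (λ k y i<k → cong ((σ i <ᵇ y) ∧_) (trans (cong ((y <ᵇ i) ∧_) (<ᵇ-true i<k)) (𝔹ₚ.∧-identityʳ _))))
      (countFrom-window x≤j (ℕₚ.<⇒≤ i≤m)
        (λ v v≤x → cong (λ b → (b ∧ (v <ᵇ i)) ∧ used s v) (trans (cong (_<ᵇ v) σi≡x) (<ᵇ-false v≤x)))
        (λ v x<v v≤j → cong₂ _∧_ (cong₂ _∧_ (trans (cong (_<ᵇ v) σi≡x) (<ᵇ-true x<v)) (<ᵇ-true (s≤s v≤j)))
                         (used-s v (ℕₚ.≤-<-trans z≤n x<v , ℕₚ.≤-trans v≤j (ℕₚ.<⇒≤ i≤m)) (ℕₚ.>⇒≢ x<v)))
        (λ v j<v _ → cong (_∧ used s v) (trans (cong ((σ i <ᵇ v) ∧_) (<ᵇ-false j<v)) (𝔹ₚ.∧-zeroʳ _))))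

    lnest-i : x < i → lnest i ≡ countFrom 0 (x ∸ 1) (λ v → notIn v p)
    lnest-i x<i with within-x
    ... | (s≤s {n = x′} _ , x≤m) = trans
      (suffix-count (λ k y → (y <ᵇ σ i) ∧ (σ i <ᵇ i) ∧ (i <ᵇ k)) (λ y → (y <ᵇ σ i) ∧ (σ i <ᵇ i))
        (λ k y k≤i → trans (cong (λ b → (y <ᵇ σ i) ∧ (σ i <ᵇ i) ∧ b) (<ᵇ-false k≤i))
                           (trans (cong ((y <ᵇ σ i) ∧_) (𝔹ₚ.∧-zeroʳ _)) (𝔹ₚ.∧-zeroʳ _)))
        (λ k y i<k → cong ((y <ᵇ σ i) ∧_) (trans (cong ((σ i <ᵇ i) ∧_) (<ᵇ-true i<k)) (𝔹ₚ.∧-identityʳ _))))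
      (countFrom-window z≤n (ℕₚ.≤-trans (ℕₚ.n≤1+n _) x≤m) zero-case
        (λ v 0<v v≤x′ → cong₂ _∧_ (cong₂ _∧_ (trans (cong (v <ᵇ_) σi≡x) (<ᵇ-true (s≤s v≤x′)))
                                            (trans (cong (_<ᵇ i) σi≡x) (<ᵇ-true x<i)))
                         (used-s v (0<v , ℕₚ.≤-trans v≤x′ (ℕₚ.≤-trans (ℕₚ.n≤1+n _) x≤m)) (ℕₚ.<⇒≢ (s≤s v≤x′))))
        (λ v x′<v _ → cong (λ b → (b ∧ (σ i <ᵇ i)) ∧ used s v)
                        (trans (cong (v <ᵇ_) σi≡x) (<ᵇ-false x′<v))))
      where
      notIn-0 : ∀ {s} → All (Within m) s → notIn 0 s ≡ true
      notIn-0 []                       = refl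
      notIn-0 ((s≤s _ , _) ∷ all) = notIn-0 all
      -- The window starts at `0`, so the only value to exclude below it is `0` itself, which is not
      -- a letter.
      zero-case : ∀ v → v ≤ 0 → ((v <ᵇ σ i) ∧ (σ i <ᵇ i)) ∧ used s v ≡ false
      zero-case v z≤n = trans (cong (((0 <ᵇ σ i) ∧ (σ i <ᵇ i)) ∧_) (cong not (notIn-0 within-s))) (𝔹ₚ.∧-zeroʳ _)

    σ⁻¹-before : notIn i p ≡ false → σ⁻¹ i < i
    σ⁻¹-before i∈p = s≤s (subst (_≤ j) (sym (invAt-firstIndex w i)) (firstIndex-≤ i p (x ∷ s) i∈p))

    σ⁻¹-after : notIn i p ≡ true → x ≢ i → i < σ⁻¹ i
    σ⁻¹-after i∉p x≢i = subst (i <_) (sym (trans (invAt-firstIndex w i) (firstIndex-skip i (x ∷ p) s i∉xp)))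
      (firstIndex-> i i s (𝔹ₚ.not-injective (trans (used-s i (s≤s z≤n , i≤m) (x≢i ∘ sym)) i∉p)))
      where
      i∉xp : notIn i (x ∷ p) ≡ true
      i∉xp = cong₂ (λ b c → not b ∧ c) (≡ᵇ-false (x≢i ∘ sym)) i∉p

open WordCombinatorics

-- Finite sums in the coefficient ring.

module FiniteSums {c ℓ : Level} (R : CommutativeRing c ℓ) where
  open CommutativeRing R
  open import Algebra.Properties.CommutativeSemigroup +-commutativeSemigroup
    using (interchange)
  open import Relation.Binary.Reasoning.Setoid setoid

  ∑ : ℕ → (ℕ → Carrier) → Carrier
  ∑ zero    g = 0#
  ∑ (suc n) g = g 0 + ∑ n (g ∘ suc)

  ∑-cong : ∀ n {g h : ℕ → Carrier} → (∀ t → t < n → g t ≈ h t) → ∑ n g ≈ ∑ n h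
  ∑-cong zero    eq = refl
  ∑-cong (suc n) eq = +-cong (eq 0 (s≤s z≤n)) (∑-cong n λ t t<n → eq (suc t) (s≤s t<n))

  ∑-zero : ∀ n {g : ℕ → Carrier} → (∀ t → t < n → g t ≈ 0#) → ∑ n g ≈ 0#
  ∑-zero zero    eq = refl
  ∑-zero (suc n) eq =
    trans (+-cong (eq 0 (s≤s z≤n)) (∑-zero n λ t t<n → eq (suc t) (s≤s t<n))) (+-identityˡ 0#)

  ∑-+ : ∀ n (g h : ℕ → Carrier) → ∑ n (λ t → g t + h t) ≈ ∑ n g + ∑ n h
  ∑-+ zero    g h = sym (+-identityˡ 0#)
  ∑-+ (suc n) g h = trans (+-congˡ (∑-+ n (g ∘ suc) (h ∘ suc))) (interchange _ _ _ _)

  ∑-*ˡ : ∀ n x (g : ℕ → Carrier) → ∑ n (λ t → x * g t) ≈ x * ∑ n g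
  ∑-*ˡ zero    x g = sym (zeroʳ x)
  ∑-*ˡ (suc n) x g = trans (+-congˡ (∑-*ˡ n x (g ∘ suc))) (sym (distribˡ x _ _))

  ∑-*ʳ : ∀ n x (g : ℕ → Carrier) → ∑ n (λ t → g t * x) ≈ ∑ n g * x
  ∑-*ʳ zero    x g = sym (zeroˡ x)
  ∑-*ʳ (suc n) x g = trans (+-congˡ (∑-*ʳ n x (g ∘ suc))) (sym (distribʳ x _ _))

  ∑-split : ∀ m n (g : ℕ → Carrier) → ∑ (m N.+ n) g ≈ ∑ m g + ∑ n (λ t → g (m N.+ t))
  ∑-split zero    n g = sym (+-identityˡ _)
  ∑-split (suc m) n g = trans (+-congˡ (∑-split m n (g ∘ suc))) (sym (+-assoc _ _ _))

  ∑-last : ∀ n (g : ℕ → Carrier) → ∑ (suc n) g ≈ ∑ n g + g n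
  ∑-last zero    g = trans (+-identityʳ _) (sym (+-identityˡ _))
  ∑-last (suc n) g = trans (+-congˡ (∑-last n (g ∘ suc))) (sym (+-assoc _ _ _))

  ∑-swap : ∀ m n (g : ℕ → ℕ → Carrier) →
           ∑ m (λ s → ∑ n (λ t → g s t)) ≈ ∑ n (λ t → ∑ m (λ s → g s t))
  ∑-swap zero    n g = sym (∑-zero n λ _ _ → refl)
  ∑-swap (suc m) n g = trans (+-congˡ (∑-swap m n (g ∘ suc))) (sym (∑-+ n (g 0) _))

  -- `sumInside-∑` lists the elements of a set by increasing rank, so the first index grows, whereas
  -- in `diagSum` the second index grows.
  ∑-reverse : ∀ n (g : ℕ → ℕ → Carrier) →
              ∑ n (λ t → g (n ∸ 1 ∸ t) t) ≈ ∑ n (λ t → g t (n ∸ 1 ∸ t))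
  ∑-reverse zero    g = refl
  ∑-reverse (suc n) g = begin
    g n 0 + ∑ n (λ t → g (n ∸ suc t) (suc t))
      ≈⟨ +-congˡ (∑-cong n λ t _ → reflexive (cong (λ s → g s (suc t)) (ℕₚ.∸-+-assoc n 1 t))) ⟨
    g n 0 + ∑ n (λ t → g (n ∸ 1 ∸ t) (suc t))
      ≈⟨ +-congˡ (∑-reverse n (λ s t → g s (suc t))) ⟩
    g n 0 + ∑ n (λ t → g t (suc (n ∸ 1 ∸ t)))
      ≈⟨ +-comm _ _ ⟩
    ∑ n (λ t → g t (suc (n ∸ 1 ∸ t))) + g n 0
      ≈⟨ +-cong (∑-cong n λ t t<n → reflexive (cong (g t) (suc-pred-∸ t<n)))
                (reflexive (cong (g n) (≡.sym (ℕₚ.n∸n≡0 n)))) ⟩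
    ∑ n (λ t → g t (n ∸ t)) + g n (n ∸ n)
      ≈⟨ ∑-last n (λ t → g t (n ∸ t)) ⟨
    ∑ (suc n) (λ t → g t (n ∸ t)) ∎
    where
    suc-pred-∸ : ∀ {t n} → t < n → suc (n ∸ 1 ∸ t) ≡ n ∸ t
    suc-pred-∸ {t} {suc n} (s≤s t≤n) = ≡.sym (ℕₚ.+-∸-assoc 1 t≤n)

  sumR-upTo : ∀ n (g : ℕ → Carrier) (h : ℕ → ℕ) →
              sumR R (map g (applyUpTo h n)) ≡ ∑ n (g ∘ h)
  sumR-upTo zero    g h = ≡.refl
  sumR-upTo (suc n) g h = cong (g (h 0) +_) (sumR-upTo n g (h ∘ suc))

-- The Cauchy product and the geometric series.

module SeriesProduct {c ℓ : Level} (R : CommutativeRing c ℓ) where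
  open CommutativeRing R
  open FiniteSums R
  open import Relation.Binary.Reasoning.Setoid setoid
  open import Algebra.Solver.Ring.NaturalCoefficients.Default commutativeSemiring
    using (solve; _:=_; _:+_; _:*_)

  infix 4 _≋_
  _≋_ : Series R → Series R → Set ℓ
  u ≋ v = ∀ n → u n ≈ v n

  infixl 8 _⊛_

  -- Opaque, so that the factors of a product can be inferred from it.
  opaque
    _⊛_ : Series R → Series R → Series R
    u ⊛ v = conv R u v

    ⊛-conv : ∀ u v → u ⊛ v ≋ conv R u v
    ⊛-conv u v n = refl

    ⊛-∑ : ∀ u v n → (u ⊛ v) n ≈ ∑ (suc n) (λ k → u k * v (n ∸ k))
    ⊛-∑ u v n = reflexive (sumR-upTo (suc n) (λ k → u k * v (n ∸ k)) id)

    ⊛-zero : ∀ u v → (u ⊛ v) 0 ≈ u 0 * v 0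
    ⊛-zero u v = +-identityʳ _

    ⊛-suc : ∀ u v n → (u ⊛ v) (suc n) ≈ u 0 * v (suc n) + ((u ∘ suc) ⊛ v) n
    ⊛-suc u v n = trans (⊛-∑ u v (suc n)) (+-congˡ (sym (⊛-∑ (u ∘ suc) v n)))

  ⊛-cong≤ : ∀ {u u′ v v′} n → (∀ k → k ≤ n → u k ≈ u′ k) → (∀ k → k ≤ n → v k ≈ v′ k) →
            (u ⊛ v) n ≈ (u′ ⊛ v′) n
  ⊛-cong≤ {u} {u′} {v} {v′} n eq₁ eq₂ = begin
    (u ⊛ v) n                            ≈⟨ ⊛-∑ u v n ⟩
    ∑ (suc n) (λ k → u k * v (n ∸ k))    ≈⟨ ∑-cong (suc n) (λ k k≤n →
                                              *-cong (eq₁ k (s≤s⁻¹ k≤n)) (eq₂ (n ∸ k) (ℕₚ.m∸n≤m n k))) ⟩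
    ∑ (suc n) (λ k → u′ k * v′ (n ∸ k))  ≈⟨ ⊛-∑ u′ v′ n ⟨
    (u′ ⊛ v′) n                          ∎

  ⊛-congˡ : ∀ {u v v′} → v ≋ v′ → u ⊛ v ≋ u ⊛ v′
  ⊛-congˡ eq n = ⊛-cong≤ n (λ _ _ → refl) (λ k _ → eq k)

  ⊛-congʳ : ∀ {u u′ v} → u ≋ u′ → u ⊛ v ≋ u′ ⊛ v
  ⊛-congʳ eq n = ⊛-cong≤ n (λ k _ → eq k) (λ _ _ → refl)

  -- Stated for a combination of two series because the shifted product in `⊛-assoc` and the right
  -- sides of `tfrac-suc` and `tail-⊛-suc` have this shape, with a coefficient `1#` put in where
  -- there is none.
  ⊛-distribʳ : ∀ x u y v w →
    (λ n → x * u n + y * v n) ⊛ w ≋ λ n → x * (u ⊛ w) n + y * (v ⊛ w) n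
  ⊛-distribʳ x u y v w zero = begin
    ((λ n → x * u n + y * v n) ⊛ w) 0  ≈⟨ ⊛-zero _ w ⟩
    (x * u 0 + y * v 0) * w 0          ≈⟨ solve 5 (λ x u y v w → (x :* u :+ y :* v) :* w
                                              := x :* (u :* w) :+ y :* (v :* w)) refl x (u 0) y (v 0) (w 0) ⟩
    x * (u 0 * w 0) + y * (v 0 * w 0)  ≈⟨ +-cong (*-congˡ (⊛-zero u w)) (*-congˡ (⊛-zero v w)) ⟨
    x * (u ⊛ w) 0 + y * (v ⊛ w) 0      ∎
  ⊛-distribʳ x u y v w (suc n) = begin
    ((λ n → x * u n + y * v n) ⊛ w) (suc n)
      ≈⟨ ⊛-suc _ w n ⟩
    (x * u 0 + y * v 0) * w (suc n) + ((λ n → x * u (suc n) + y * v (suc n)) ⊛ w) n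
      ≈⟨ +-congˡ (⊛-distribʳ x (u ∘ suc) y (v ∘ suc) w n) ⟩
    (x * u 0 + y * v 0) * w (suc n) + (x * ((u ∘ suc) ⊛ w) n + y * ((v ∘ suc) ⊛ w) n)
      ≈⟨ solve 7 (λ x u y v w p q → (x :* u :+ y :* v) :* w :+ (x :* p :+ y :* q)
                   := x :* (u :* w :+ p) :+ y :* (v :* w :+ q)) refl x (u 0) y (v 0) (w (suc n)) _ _ ⟩
    x * (u 0 * w (suc n) + ((u ∘ suc) ⊛ w) n) + y * (v 0 * w (suc n) + ((v ∘ suc) ⊛ w) n)
      ≈⟨ +-cong (*-congˡ (⊛-suc u w n)) (*-congˡ (⊛-suc v w n)) ⟨
    x * (u ⊛ w) (suc n) + y * (v ⊛ w) (suc n) ∎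

  ⊛-*ʳ : ∀ u x v → u ⊛ (λ n → x * v n) ≋ λ n → x * (u ⊛ v) n
  ⊛-*ʳ u x v n = begin
    (u ⊛ (λ n → x * v n)) n                  ≈⟨ ⊛-∑ u _ n ⟩
    ∑ (suc n) (λ k → u k * (x * v (n ∸ k)))  ≈⟨ ∑-cong (suc n) (λ k _ →
                                                  solve 3 (λ u x v → u :* (x :* v) := x :* (u :* v))
                                                    refl (u k) x (v (n ∸ k))) ⟩
    ∑ (suc n) (λ k → x * (u k * v (n ∸ k)))  ≈⟨ ∑-*ˡ (suc n) x (λ k → u k * v (n ∸ k)) ⟩
    x * ∑ (suc n) (λ k → u k * v (n ∸ k))    ≈⟨ *-congˡ (⊛-∑ u v n) ⟨
    x * (u ⊛ v) n                            ∎

  ⊛-tmulʳ : ∀ u v → u ⊛ tmul R v ≋ tmul R (u ⊛ v)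
  ⊛-tmulʳ u v zero    = trans (⊛-zero u _) (zeroʳ _)
  ⊛-tmulʳ u v (suc n) = trans (⊛-suc u _ n) (tail u n)
    where
    tail : ∀ u n → u 0 * v n + ((u ∘ suc) ⊛ tmul R v) n ≈ (u ⊛ v) n
    tail u zero    = trans (+-congˡ (trans (⊛-zero _ _) (zeroʳ _)))
                           (trans (+-identityʳ _) (sym (⊛-zero u v)))
    tail u (suc n) = trans (+-congˡ (trans (⊛-suc _ _ n) (tail (u ∘ suc) n)))
                           (sym (⊛-suc u v n))

  ⊛-assoc : ∀ u v w → u ⊛ v ⊛ w ≋ u ⊛ (v ⊛ w)
  ⊛-assoc u v w zero = begin
    (u ⊛ v ⊛ w) 0      ≈⟨ ⊛-zero _ w ⟩
    (u ⊛ v) 0 * w 0    ≈⟨ *-congʳ (⊛-zero u v) ⟩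
    u 0 * v 0 * w 0    ≈⟨ *-assoc _ _ _ ⟩
    u 0 * (v 0 * w 0)  ≈⟨ *-congˡ (⊛-zero v w) ⟨
    u 0 * (v ⊛ w) 0    ≈⟨ ⊛-zero u _ ⟨
    (u ⊛ (v ⊛ w)) 0    ∎
  ⊛-assoc u v w (suc n) = begin
    (u ⊛ v ⊛ w) (suc n)
      ≈⟨ ⊛-suc _ w n ⟩
    (u ⊛ v) 0 * w (suc n) + ((λ k → (u ⊛ v) (suc k)) ⊛ w) n
      ≈⟨ +-cong (*-congʳ (⊛-zero u v))
                (⊛-congʳ {v = w} (λ k → trans (⊛-suc u v k) (+-congˡ (sym (*-identityˡ _)))) n) ⟩
    u 0 * v 0 * w (suc n) + ((λ k → u 0 * v (suc k) + 1# * ((u ∘ suc) ⊛ v) k) ⊛ w) n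
      ≈⟨ +-congˡ (⊛-distribʳ (u 0) (v ∘ suc) 1# ((u ∘ suc) ⊛ v) w n) ⟩
    u 0 * v 0 * w (suc n) + (u 0 * ((v ∘ suc) ⊛ w) n + 1# * ((u ∘ suc) ⊛ v ⊛ w) n)
      ≈⟨ +-congˡ (+-congˡ (trans (*-identityˡ _) (⊛-assoc (u ∘ suc) v w n))) ⟩
    u 0 * v 0 * w (suc n) + (u 0 * ((v ∘ suc) ⊛ w) n + ((u ∘ suc) ⊛ (v ⊛ w)) n)
      ≈⟨ solve 5 (λ u v w p q → u :* v :* w :+ (u :* p :+ q) := u :* (v :* w :+ p) :+ q) refl (u 0) (v 0) (w (suc n)) _ _ ⟩
    u 0 * (v 0 * w (suc n) + ((v ∘ suc) ⊛ w) n) + ((u ∘ suc) ⊛ (v ⊛ w)) n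
      ≈⟨ +-congʳ (*-congˡ (⊛-suc v w n)) ⟨
    u 0 * (v ⊛ w) (suc n) + ((u ∘ suc) ⊛ (v ⊛ w)) n
      ≈⟨ ⊛-suc u _ n ⟨
    (u ⊛ (v ⊛ w)) (suc n) ∎

  ⊛-constˡ : ∀ x v → constS R x ⊛ v ≋ λ n → x * v n
  ⊛-constˡ x v zero    = ⊛-zero _ v
  ⊛-constˡ x v (suc n) = begin
    (constS R x ⊛ v) (suc n)            ≈⟨ ⊛-suc _ v n ⟩
    x * v (suc n) + ((λ _ → 0#) ⊛ v) n  ≈⟨ +-congˡ (trans (⊛-∑ _ v n) (∑-zero (suc n) λ k _ → zeroˡ (v (n ∸ k)))) ⟩
    x * v (suc n) + 0#                  ≈⟨ +-identityʳ _ ⟩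
    x * v (suc n)                       ∎

  powS-suc : ∀ u j → powS R u (suc j) ≋ u ⊛ powS R u j
  powS-suc u j n = sym (⊛-conv u (powS R u j) n)

  -- Every factor carries at least one power of `t`. So `geomInv` loses nothing by stopping at the
  -- exponent `n`.
  powS-tmul-vanish : ∀ u j n → n < j → powS R (tmul R u) j n ≈ 0#
  powS-tmul-vanish u (suc j) zero    _         =
    trans (powS-suc (tmul R u) j 0) (trans (⊛-zero _ _) (zeroˡ _))
  powS-tmul-vanish u (suc j) (suc n) (s≤s n<j) = begin
    powS R (tmul R u) (suc j) (suc n)
      ≈⟨ powS-suc (tmul R u) j (suc n) ⟩
    (tmul R u ⊛ powS R (tmul R u) j) (suc n)
      ≈⟨ ⊛-suc _ _ n ⟩
    0# * powS R (tmul R u) j (suc n) + (u ⊛ powS R (tmul R u) j) n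
      ≈⟨ +-cong (zeroˡ _) (trans (⊛-∑ u _ n) (∑-zero (suc n) λ k _ →
           trans (*-congˡ (powS-tmul-vanish u j (n ∸ k) (ℕₚ.≤-<-trans (ℕₚ.m∸n≤m n k) n<j))) (zeroʳ (u k)))) ⟩
    0# + 0#
      ≈⟨ +-identityˡ 0# ⟩
    0# ∎

  geomInv-zero : ∀ u → geomInv R u 0 ≈ 1#
  geomInv-zero u = +-identityʳ _

  -- The truncation may be moved past `n`, so one common bound serves all the coefficients that
  -- enter a convolution.
  geomInv-∑ : ∀ u n r → geomInv R (tmul R u) n ≈ ∑ (suc n N.+ r) (λ j → powS R (tmul R u) j n)
  geomInv-∑ u n r = begin
    geomInv R (tmul R u) n
      ≈⟨ reflexive (sumR-upTo (suc n) (λ j → powS R (tmul R u) j n) id) ⟩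
    ∑ (suc n) (λ j → powS R (tmul R u) j n)
      ≈⟨ +-identityʳ _ ⟨
    ∑ (suc n) (λ j → powS R (tmul R u) j n) + 0#
      ≈⟨ +-congˡ (∑-zero r λ t _ → powS-tmul-vanish u (suc n N.+ t) n (s≤s (ℕₚ.m≤m+n n t))) ⟨
    ∑ (suc n) (λ j → powS R (tmul R u) j n) + ∑ r (λ t → powS R (tmul R u) (suc n N.+ t) n)
      ≈⟨ ∑-split (suc n) r (λ j → powS R (tmul R u) j n) ⟨
    ∑ (suc n N.+ r) (λ j → powS R (tmul R u) j n) ∎

  -- The equation g = 1 + t u g for g = 1/(1 - t u): each power after the zeroth sheds one factor t
  -- u, and exchanging the two sums collects the remaining powers into g.
  geomInv-suc : ∀ u n → geomInv R (tmul R u) (suc n) ≈ (u ⊛ geomInv R (tmul R u)) n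
  geomInv-suc u n = begin
    geomInv R (tmul R u) (suc n)
      ≈⟨ reflexive (sumR-upTo (suc (suc n)) (λ j → p j (suc n)) id) ⟩
    0# + ∑ (suc n) (λ j → p (suc j) (suc n))
      ≈⟨ +-identityˡ _ ⟩
    ∑ (suc n) (λ j → p (suc j) (suc n))
      ≈⟨ ∑-cong (suc n) (λ j _ → trans (powS-suc (tmul R u) j (suc n)) (trans (⊛-suc _ (p j) n)
           (trans (+-cong (zeroˡ _) (⊛-∑ u (p j) n)) (+-identityˡ _)))) ⟩
    ∑ (suc n) (λ j → ∑ (suc n) (λ k → u k * p j (n ∸ k)))
      ≈⟨ ∑-swap (suc n) (suc n) (λ j k → u k * p j (n ∸ k)) ⟩
    ∑ (suc n) (λ k → ∑ (suc n) (λ j → u k * p j (n ∸ k)))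
      ≈⟨ ∑-cong (suc n) (λ k k≤n → trans (∑-*ˡ (suc n) (u k) (λ j → p j (n ∸ k))) (*-congˡ (inner k (s≤s⁻¹ k≤n)))) ⟩
    ∑ (suc n) (λ k → u k * geomInv R (tmul R u) (n ∸ k))
      ≈⟨ ⊛-∑ u _ n ⟨
    (u ⊛ geomInv R (tmul R u)) n ∎
    where
    p = powS R (tmul R u)
    inner : ∀ k → k ≤ n → ∑ (suc n) (λ j → p j (n ∸ k)) ≈ geomInv R (tmul R u) (n ∸ k)
    inner k k≤n = sym (trans (geomInv-∑ u (n ∸ k) k)
      (reflexive (cong (λ l → ∑ (suc l) (λ j → p j (n ∸ k))) (ℕₚ.m∸n+n≡m k≤n))))

-- Tails of the T-fraction.

module TFraction {c ℓ : Level} (R : CommutativeRing c ℓ)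
                 (α δ : ℕ → CommutativeRing.Carrier R) where
  open CommutativeRing R
  open SeriesProduct R
  open import Relation.Binary.Reasoning.Setoid setoid

  tfrac-zero : ∀ d i → tfrac R α δ d i 0 ≈ 1#
  tfrac-zero zero    i = refl
  tfrac-zero (suc d) i = geomInv-zero (tmul R (λ n → constS R (δ i) n + α i * tfrac R α δ d (suc i) n))

  tfrac-suc : ∀ d i n → tfrac R α δ (suc d) i (suc n) ≈
    δ i * tfrac R α δ (suc d) i n + α i * (tfrac R α δ d (suc i) ⊛ tfrac R α δ (suc d) i) n
  tfrac-suc d i n = begin
    tfrac R α δ (suc d) i (suc n)
      ≈⟨ geomInv-suc _ n ⟩
    ((λ n → constS R (δ i) n + α i * tfrac R α δ d (suc i) n) ⊛ g) n
      ≈⟨ ⊛-congʳ (λ k → +-congʳ (sym (*-identityˡ (constS R (δ i) k)))) n ⟩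
    ((λ n → 1# * constS R (δ i) n + α i * tfrac R α δ d (suc i) n) ⊛ g) n
      ≈⟨ ⊛-distribʳ 1# (constS R (δ i)) (α i) (tfrac R α δ d (suc i)) g n ⟩
    1# * (constS R (δ i) ⊛ g) n + α i * (tfrac R α δ d (suc i) ⊛ g) n
      ≈⟨ +-congʳ (trans (*-identityˡ _) (⊛-constˡ (δ i) g n)) ⟩
    δ i * g n + α i * (tfrac R α δ d (suc i) ⊛ g) n ∎
    where g = tfrac R α δ (suc d) i

  -- `tfrac-suc` gives up at most one level of depth for each degree it descends, so levels deeper
  -- than the degree are never reached. The convolution visits all degrees `k ≤ n`; the bound `N`,
  -- lowered at each call, makes the recursion structural.
  tfrac-stable : ∀ N n d d′ i → n ≤ N → n < d → n < d′ →
                 tfrac R α δ d i n ≈ tfrac R α δ d′ i n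
  tfrac-stable N zero d d′ i _ _ _ = trans (tfrac-zero d i) (sym (tfrac-zero d′ i))
  tfrac-stable (suc N) (suc n) (suc d) (suc d′) i (s≤s n≤N) (s≤s n<d) (s≤s n<d′) = begin
    tfrac R α δ (suc d) i (suc n)
      ≈⟨ tfrac-suc d i n ⟩
    δ i * tfrac R α δ (suc d) i n + α i * (tfrac R α δ d (suc i) ⊛ tfrac R α δ (suc d) i) n
      ≈⟨ +-cong (*-congˡ (same n ℕₚ.≤-refl))
                (*-congˡ (⊛-cong≤ n (λ k k≤n → tfrac-stable N k d d′ (suc i)
                  (ℕₚ.≤-trans k≤n n≤N) (ℕₚ.≤-<-trans k≤n n<d) (ℕₚ.≤-<-trans k≤n n<d′)) same)) ⟩
    δ i * tfrac R α δ (suc d′) i n + α i * (tfrac R α δ d′ (suc i) ⊛ tfrac R α δ (suc d′) i) n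
      ≈⟨ tfrac-suc d′ i n ⟨
    tfrac R α δ (suc d′) i (suc n) ∎
    where
    same : ∀ k → k ≤ n → tfrac R α δ (suc d) i k ≈ tfrac R α δ (suc d′) i k
    same k k≤n = tfrac-stable N k (suc d) (suc d′) i (ℕₚ.≤-trans k≤n n≤N)
      (s≤s (ℕₚ.≤-trans k≤n (ℕₚ.<⇒≤ n<d))) (s≤s (ℕₚ.≤-trans k≤n (ℕₚ.<⇒≤ n<d′)))

  -- The infinite fraction from level `i` on, with each coefficient taken from the shallowest
  -- truncation covered by `tfrac-stable`. `tail 1` is `Tcoeff` by definition.
  tail : ℕ → Series R
  tail i n = tfrac R α δ (suc n) i n

  tail-suc : ∀ i n → tail i (suc n) ≈ δ i * tail i n + α i * (tail (suc i) ⊛ tail i) n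
  tail-suc i n = trans (tfrac-suc (suc n) i n)
    (+-cong (*-congˡ (tfrac-stable n n (suc (suc n)) (suc n) i ℕₚ.≤-refl (s≤s (ℕₚ.n≤1+n n)) ℕₚ.≤-refl))
            (*-congˡ (⊛-cong≤ n
              (λ k k≤n → tfrac-stable n k (suc n) (suc k) (suc i) k≤n (s≤s k≤n) ℕₚ.≤-refl)
              (λ k k≤n → tfrac-stable n k (suc (suc n)) (suc k) i k≤n (s≤s (ℕₚ.m≤n⇒m≤1+n k≤n)) ℕₚ.≤-refl))))

  tail-⊛-zero : ∀ i v → (tail i ⊛ v) 0 ≈ v 0
  tail-⊛-zero i v = trans (⊛-zero _ v) (trans (*-congʳ (tfrac-zero 1 i)) (*-identityˡ _))

  -- `tail-suc` multiplied by `v` and reassociated so that the block `tail i ⊛ v` reappears; in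
  -- `W-step` the series `v` is itself a product that begins with a tail.
  tail-⊛-suc : ∀ i v n → (tail i ⊛ v) (suc n) ≈
    v (suc n) + (δ i * (tail i ⊛ v) n + α i * (tail (suc i) ⊛ (tail i ⊛ v)) n)
  tail-⊛-suc i v n = begin
    (tail i ⊛ v) (suc n)
      ≈⟨ ⊛-suc _ v n ⟩
    tail i 0 * v (suc n) + ((λ k → tail i (suc k)) ⊛ v) n
      ≈⟨ +-cong (trans (*-congʳ (tfrac-zero 1 i)) (*-identityˡ _))
                (⊛-congʳ (λ k → tail-suc i k) n) ⟩
    v (suc n) + ((λ k → δ i * tail i k + α i * (tail (suc i) ⊛ tail i) k) ⊛ v) n
      ≈⟨ +-congˡ (⊛-distribʳ (δ i) (tail i) (α i) (tail (suc i) ⊛ tail i) v n) ⟩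
    v (suc n) + (δ i * (tail i ⊛ v) n + α i * (tail (suc i) ⊛ tail i ⊛ v) n)
      ≈⟨ +-congˡ (+-congˡ (*-congˡ (⊛-assoc _ _ v n))) ⟩
    v (suc n) + (δ i * (tail i ⊛ v) n + α i * (tail (suc i) ⊛ (tail i ⊛ v)) n) ∎

-- Doubling, parity and weighted paths.

-- Unlike `2 * n`, this unfolds to two successors by computation, in step with `isEven` and with the
-- two path steps per degree.
double : ℕ → ℕ
double zero    = zero
double (suc n) = suc (suc (double n))

isEven-double : ∀ n → isEven (double n) ≡ true
isEven-double zero    = ≡.refl
isEven-double (suc n) = isEven-double n

isEven-suc-double : ∀ n → isEven (suc (double n)) ≡ false
isEven-suc-double zero    = ≡.refl
isEven-suc-double (suc n) = isEven-suc-double n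

half-double : ∀ n → N.⌊ double n /2⌋ ≡ n
half-double zero    = ≡.refl
half-double (suc n) = cong suc (half-double n)

half-suc-double : ∀ n → N.⌊ suc (double n) /2⌋ ≡ n
half-suc-double zero    = ≡.refl
half-suc-double (suc n) = cong suc (half-suc-double n)

double≡2* : ∀ n → double n ≡ 2 N.* n
double≡2* zero    = ≡.refl
double≡2* (suc n) = cong suc (≡.trans (cong suc (double≡2* n)) (≡.sym (ℕₚ.+-suc n (n N.+ 0))))

-- Partial sums over paths that start at height h and end at 0 with k steps left.  The parity of k
-- determines the kind of the next step: level (E) or down (B) if k is odd, level (F) or up (A) if
-- k is even.
module PathSum {c ℓ : Level} (R : CommutativeRing c ℓ)
               (A B E F : ℕ → CommutativeRing.Carrier R) where
  open CommutativeRing R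

  pathSum : ℕ → ℕ → Carrier
  pathSum zero    zero    = 1#
  pathSum zero    (suc h) = 0#
  pathSum (suc k) h       =
    if isEven k then E h * pathSum k h + B h * pathSum k (h ∸ 1)
                else F h * pathSum k h + A (suc h) * pathSum k (suc h)

-- Even contraction: pairs of path steps against the T-fraction.

module Contraction {c ℓ : Level} (R : CommutativeRing c ℓ) where
  open CommutativeRing R hiding (zero)

  module _ (A B E F α δ : ℕ → Carrier)
    -- At height `0` the truncated `h ∸ 1` would let a down step stay at `0`, so its weight has to
    -- vanish.
    (B₀ : B 0 ≈ 0#)
    (α-odd  : ∀ h → α (suc (double h)) ≈ A (suc h) * B (suc h))
    (α-even : ∀ h → α (suc (suc (double h))) ≈ E (suc h) * F (suc h))
    (δ-one  : δ 1 ≈ E 0 * F 0)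
    (δ-rest : ∀ i → δ (suc (suc i)) ≈ 0#)
    where
    open SeriesProduct R
    open TFraction R α δ
    open PathSum R A B E F
    open import Relation.Binary.Reasoning.Setoid setoid
    open import Algebra.Solver.Ring.NaturalCoefficients.Default commutativeSemiring
      using (solve; _:=_; _:+_; _:*_)

    -- First-passage decomposition: a path from h + 1 to 0 splits at its first visit to h.
    W : ℕ → Series R
    W zero    = tail 1
    W (suc h) = tail (3 N.+ double h) ⊛ (tail (2 N.+ double h) ⊛ λ n → F (suc h) * B (suc h) * tmul R (W h) n)

    -- `W` has the factor `t` innermost, where `tail-⊛-suc` can peel the two tails in turn. With `t`
    -- outermost the constant coefficient visibly vanishes and the others are a multiple of a
    -- product with `W h`.
    W-suc-tmul : ∀ h → W (suc h) ≋
      λ n → F (suc h) * B (suc h) * tmul R (tail (3 N.+ double h) ⊛ (tail (2 N.+ double h) ⊛ W h)) n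
    W-suc-tmul h n = begin
      W (suc h) n
        ≈⟨ ⊛-congˡ (λ k → trans (⊛-*ʳ u₂ x (tmul R (W h)) k) (*-congˡ (⊛-tmulʳ u₂ (W h) k))) n ⟩
      (u₃ ⊛ λ n → x * tmul R (u₂ ⊛ W h) n) n
        ≈⟨ ⊛-*ʳ u₃ x (tmul R (u₂ ⊛ W h)) n ⟩
      x * (u₃ ⊛ tmul R (u₂ ⊛ W h)) n
        ≈⟨ *-congˡ (⊛-tmulʳ u₃ (u₂ ⊛ W h) n) ⟩
      x * tmul R (u₃ ⊛ (u₂ ⊛ W h)) n ∎
      where
      u₂ u₃ : Series R
      u₂ = tail (2 N.+ double h)
      u₃ = tail (3 N.+ double h)
      x = F (suc h) * B (suc h)

    -- The right side is an up step followed by a level or a down step. Expanding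
    -- `tail (2 + double h)` once gives both: its constant term leaves `A * B * W h`, and its `α`
    -- term leaves `A * B * E * F` times a product in which `F * B` is the first-passage factor of
    -- `W (suc h)`.
    W-up : ∀ h n → α (suc (double h)) * (tail (2 N.+ double h) ⊛ W h) n ≈
           A (suc h) * (E (suc h) * W (suc h) n + B (suc h) * W h n)
    W-up h zero = begin
      α (suc (double h)) * (tail (2 N.+ double h) ⊛ W h) 0
        ≈⟨ *-cong (α-odd h) (tail-⊛-zero _ (W h)) ⟩
      A (suc h) * B (suc h) * W h 0
        ≈⟨ *-assoc _ _ _ ⟩
      A (suc h) * (B (suc h) * W h 0)
        ≈⟨ *-congˡ (+-identityˡ _) ⟨
      A (suc h) * (0# + B (suc h) * W h 0)
        ≈⟨ *-congˡ (+-congʳ (trans (*-congˡ (trans (W-suc-tmul h 0) (zeroʳ _))) (zeroʳ _))) ⟨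
      A (suc h) * (E (suc h) * W (suc h) 0 + B (suc h) * W h 0) ∎
    W-up h (suc n) = begin
      α (suc (double h)) * (tail (2 N.+ double h) ⊛ W h) (suc n)
        ≈⟨ *-cong (α-odd h) (tail-⊛-suc _ (W h) n) ⟩
      A (suc h) * B (suc h) * (W h (suc n) + (δ (2 N.+ double h) * (tail (2 N.+ double h) ⊛ W h) n
                                              + α (2 N.+ double h) * V n))
        ≈⟨ *-congˡ (+-congˡ (+-cong (trans (*-congʳ (δ-rest _)) (zeroˡ _)) (*-congʳ (α-even h)))) ⟩
      A (suc h) * B (suc h) * (W h (suc n) + (0# + E (suc h) * F (suc h) * V n))
        ≈⟨ *-congˡ (+-congˡ (+-identityˡ _)) ⟩
      A (suc h) * B (suc h) * (W h (suc n) + E (suc h) * F (suc h) * V n)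
        ≈⟨ solve 6 (λ a b e f w v → a :* b :* (w :+ e :* f :* v) := a :* (e :* (f :* b :* v) :+ b :* w))
             refl (A (suc h)) (B (suc h)) (E (suc h)) (F (suc h)) (W h (suc n)) (V n) ⟩
      A (suc h) * (E (suc h) * (F (suc h) * B (suc h) * V n) + B (suc h) * W h (suc n))
        ≈⟨ *-congˡ (+-congʳ (*-congˡ (W-suc-tmul h (suc n)))) ⟨
      A (suc h) * (E (suc h) * W (suc h) (suc n) + B (suc h) * W h (suc n)) ∎
      where V = tail (3 N.+ double h) ⊛ (tail (2 N.+ double h) ⊛ W h)

    -- Above height `0`, the two tails in front of `W (suc h)` are peeled in turn. The outer one
    -- leaves the term of `W-up`, the inner one leaves `E * F * W (suc h)`, and the constant terms
    -- of both leave the descent `F * B * W h`. At height `0` the level term comes from `δ 1`.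
    W-step : ∀ h n → W h (suc n) ≈
      F h * (E h * W h n + B h * W (h ∸ 1) n) + A (suc h) * (E (suc h) * W (suc h) n + B (suc h) * W h n)
    W-step zero n = begin
      tail 1 (suc n)
        ≈⟨ tail-suc 1 n ⟩
      δ 1 * tail 1 n + α 1 * (tail 2 ⊛ tail 1) n
        ≈⟨ +-cong (*-congʳ δ-one) (W-up 0 n) ⟩
      E 0 * F 0 * W 0 n + A 1 * (E 1 * W 1 n + B 1 * W 0 n)
        ≈⟨ +-congʳ (begin
             E 0 * F 0 * W 0 n                  ≈⟨ solve 3 (λ e f w → e :* f :* w := f :* (e :* w)) refl (E 0) (F 0) (W 0 n) ⟩
             F 0 * (E 0 * W 0 n)                ≈⟨ *-congˡ (+-identityʳ _) ⟨
             F 0 * (E 0 * W 0 n + 0#)           ≈⟨ *-congˡ (+-congˡ (trans (*-congʳ B₀) (zeroˡ _))) ⟨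
             F 0 * (E 0 * W 0 n + B 0 * W 0 n)  ∎) ⟩
      F 0 * (E 0 * W 0 n + B 0 * W 0 n) + A 1 * (E 1 * W 1 n + B 1 * W 0 n) ∎
    W-step (suc h) n = begin
      (tail (3 N.+ double h) ⊛ Y) (suc n)
        ≈⟨ tail-⊛-suc _ Y n ⟩
      Y (suc n) + (δ (3 N.+ double h) * W (suc h) n + α (3 N.+ double h) * (tail (4 N.+ double h) ⊛ W (suc h)) n)
        ≈⟨ +-cong (tail-⊛-suc _ (λ n → F (suc h) * B (suc h) * tmul R (W h) n) n)
                  (+-cong (trans (*-congʳ (δ-rest _)) (zeroˡ _)) (W-up (suc h) n)) ⟩
      (F (suc h) * B (suc h) * W h n + (δ (2 N.+ double h) * Y n + α (2 N.+ double h) * W (suc h) n)) + (0# + up)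
        ≈⟨ +-cong (+-congˡ (+-cong (trans (*-congʳ (δ-rest _)) (zeroˡ _)) (*-congʳ (α-even h)))) (+-identityˡ _) ⟩
      (F (suc h) * B (suc h) * W h n + (0# + E (suc h) * F (suc h) * W (suc h) n)) + up
        ≈⟨ +-congʳ (+-congˡ (+-identityˡ _)) ⟩
      (F (suc h) * B (suc h) * W h n + E (suc h) * F (suc h) * W (suc h) n) + up
        ≈⟨ +-congʳ (solve 5 (λ f b e w v → f :* b :* w :+ e :* f :* v := f :* (e :* v :+ b :* w))
             refl (F (suc h)) (B (suc h)) (E (suc h)) (W h n) (W (suc h) n)) ⟩
      F (suc h) * (E (suc h) * W (suc h) n + B (suc h) * W h n) + up ∎
      where
      Y = tail (2 N.+ double h) ⊛ λ n → F (suc h) * B (suc h) * tmul R (W h) n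
      up = A (2 N.+ h) * (E (2 N.+ h) * W (2 N.+ h) n + B (2 N.+ h) * W (suc h) n)

    -- Two steps of `pathSum` unfold to the recursion `W-step`, and with no steps left both sides
    -- are `1` at height `0` and `0` above.
    pathSum-W : ∀ n h → pathSum (double n) h ≈ W h n
    pathSum-W zero    zero    = sym (tfrac-zero 1 1)
    pathSum-W zero    (suc h) = sym (trans (W-suc-tmul h 0) (zeroʳ _))
    pathSum-W (suc n) h
      rewrite isEven-suc-double n | isEven-double n = trans
        (+-cong (*-congˡ (+-cong (*-congˡ (pathSum-W n h)) (*-congˡ (pathSum-W n (h ∸ 1)))))
                (*-congˡ (+-cong (*-congˡ (pathSum-W n (suc h))) (*-congˡ (pathSum-W n h)))))
        (sym (W-step h n))

    pathSum-tfrac : ∀ n → pathSum (double n) 0 ≈ Tcoeff R α δ n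
    pathSum-tfrac n = pathSum-W n 0

-- Sums over subsets of a given size.

ones : ∀ {k} → Vec Bool k → ℕ
ones []      = 0
ones (b ∷ S) = bit b N.+ ones S

module Subsets {c ℓ : Level} (R : CommutativeRing c ℓ) where
  open CommutativeRing R hiding (zero)
  open FiniteSums R
  open import Algebra.Properties.CommutativeSemigroup +-commutativeSemigroup
    using (interchange)
  open import Relation.Binary.Reasoning.Setoid setoid

  sumSub : ∀ k → ℕ → (Vec Bool k → Carrier) → Carrier
  sumSub zero    zero    F = F []
  sumSub zero    (suc h) F = 0#
  sumSub (suc k) zero    F = sumSub k zero (F ∘ (false ∷_))
  sumSub (suc k) (suc h) F = sumSub k h (F ∘ (true ∷_)) + sumSub k (suc h) (F ∘ (false ∷_))

  sumSub-cong : ∀ k h {F G : Vec Bool k → Carrier} → (∀ S → ones S ≡ h → F S ≈ G S) →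
                sumSub k h F ≈ sumSub k h G
  sumSub-cong zero    zero    eq = eq [] ≡.refl
  sumSub-cong zero    (suc h) eq = refl
  sumSub-cong (suc k) zero    eq = sumSub-cong k zero λ S → eq (false ∷ S)
  sumSub-cong (suc k) (suc h) eq =
    +-cong (sumSub-cong k h λ S → eq (true ∷ S) ∘ cong suc) (sumSub-cong k (suc h) λ S → eq (false ∷ S))

  sumSub-+ : ∀ k h (F G : Vec Bool k → Carrier) →
             sumSub k h (λ S → F S + G S) ≈ sumSub k h F + sumSub k h G
  sumSub-+ zero    zero    F G = refl
  sumSub-+ zero    (suc h) F G = sym (+-identityˡ 0#)
  sumSub-+ (suc k) zero    F G = sumSub-+ k zero _ _
  sumSub-+ (suc k) (suc h) F G =
    trans (+-cong (sumSub-+ k h _ _) (sumSub-+ k (suc h) _ _)) (interchange _ _ _ _)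

  sumSub-*ˡ : ∀ k h x (F : Vec Bool k → Carrier) → sumSub k h (λ S → x * F S) ≈ x * sumSub k h F
  sumSub-*ˡ zero    zero    x F = refl
  sumSub-*ˡ zero    (suc h) x F = sym (zeroʳ x)
  sumSub-*ˡ (suc k) zero    x F = sumSub-*ˡ k zero x _
  sumSub-*ˡ (suc k) (suc h) x F =
    trans (+-cong (sumSub-*ˡ k h x _) (sumSub-*ˡ k (suc h) x _)) (sym (distribˡ x _ _))

  -- Sum over the v ∉ S of K (#{u ∈ S : u < v}) (#{u ∈ S : u > v}) (S ∪ {v}).
  sumOutside : ∀ {k} → Vec Bool k → (ℕ → ℕ → Vec Bool k → Carrier) → Carrier
  sumOutside []      K = 0#
  sumOutside (s ∷ S) K = (if s then 0# else K 0 (ones S) (true ∷ S))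
                       + sumOutside S (λ b a S′ → K (bit s N.+ b) a (s ∷ S′))

  -- Sum over the v ∈ S of K (#{u ∈ S : u < v}) (#{u ∈ S : u > v}) S.
  sumInside : ∀ {k} → Vec Bool k → (ℕ → ℕ → Vec Bool k → Carrier) → Carrier
  sumInside []      K = 0#
  sumInside (s ∷ S) K = (if s then K 0 (ones S) (true ∷ S) else 0#)
                      + sumInside S (λ b a S′ → K (bit s N.+ b) a (s ∷ S′))

  sumInside-∑ : ∀ {k} (S : Vec Bool k) K →
                sumInside S K ≈ ∑ (ones S) (λ t → K t (ones S ∸ 1 ∸ t) S)
  sumInside-∑ []          K = refl
  sumInside-∑ (true ∷ S)  K = +-congˡ (trans (sumInside-∑ S _)
    (∑-cong (ones S) λ t _ → reflexive (cong (λ a → K (suc t) a (true ∷ S)) (ℕₚ.∸-+-assoc (ones S) 1 t))))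
  sumInside-∑ (false ∷ S) K = trans (+-identityˡ _) (sumInside-∑ S _)

  sumInside-empty : ∀ {k} (S : Vec Bool k) K → ones S ≡ 0 → sumInside S K ≈ 0#
  sumInside-empty S K eq = trans (sumInside-∑ S K)
    (reflexive (cong (λ n → ∑ n (λ t → K t (ones S ∸ 1 ∸ t) S)) eq))

  -- Both sides enumerate the pairs (S′, v) with v ∈ S′ and |S′| = h + 1.
  sumSub-sumOutside : ∀ k h K → sumSub k h (λ S → sumOutside S K) ≈ sumSub k (suc h) (λ S → sumInside S K)
  sumSub-sumOutside zero    zero    K = refl
  sumSub-sumOutside zero    (suc h) K = refl
  sumSub-sumOutside (suc k) zero    K = begin
    sumSub k 0 (λ S → K 0 (ones S) (true ∷ S) + sumOutside S (λ b a S′ → K b a (false ∷ S′)))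
      ≈⟨ sumSub-+ k 0 _ _ ⟩
    sumSub k 0 (λ S → K 0 (ones S) (true ∷ S)) + sumSub k 0 (λ S → sumOutside S (λ b a S′ → K b a (false ∷ S′)))
      ≈⟨ +-cong (sumSub-cong k 0 λ S S≡0 → trans (sym (+-identityʳ _))
                                                  (+-congˡ (sym (sumInside-empty S _ S≡0))))
                (trans (sumSub-sumOutside k 0 _) (sumSub-cong k 1 λ S _ → sym (+-identityˡ _))) ⟩
    sumSub k 0 (λ S → sumInside (true ∷ S) K) + sumSub k 1 (λ S → sumInside (false ∷ S) K) ∎
  sumSub-sumOutside (suc k) (suc h) K = begin
    -- The pairs are sorted by the least value: it already belongs to `S` (`K₁`), it is `v` itself
    -- (`K₀`), or it stays outside `S′` (`K₂`).
    sumSub k h (λ S → 0# + sumOutside S K₁) + sumSub k (suc h) (λ S → K₀ S + sumOutside S K₂)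
      ≈⟨ +-cong (trans (sumSub-cong k h λ S _ → +-identityˡ _) (sumSub-sumOutside k h K₁))
                (trans (sumSub-+ k (suc h) _ _) (+-congˡ (sumSub-sumOutside k (suc h) K₂))) ⟩
    sumSub k (suc h) (λ S → sumInside S K₁) + (sumSub k (suc h) K₀ + sumSub k (2 N.+ h) (λ S → sumInside S K₂))
      ≈⟨ trans (sym (+-assoc _ _ _)) (+-congʳ (+-comm _ _)) ⟩
    sumSub k (suc h) K₀ + sumSub k (suc h) (λ S → sumInside S K₁) + sumSub k (2 N.+ h) (λ S → sumInside S K₂)
      ≈⟨ +-cong (sym (sumSub-+ k (suc h) _ _)) (sumSub-cong k (2 N.+ h) λ S _ → sym (+-identityˡ _)) ⟩
    sumSub k (suc h) (λ S → K₀ S + sumInside S K₁) + sumSub k (2 N.+ h) (λ S → 0# + sumInside S K₂) ∎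
    where
    K₀ : Vec Bool k → Carrier
    K₀ S = K 0 (ones S) (true ∷ S)
    K₁ K₂ : ℕ → ℕ → Vec Bool k → Carrier
    K₁ b a S′ = K (suc b) a (true ∷ S′)
    K₂ b a S′ = K b a (false ∷ S′)

-- Summing the completions over all sets of one size.

module Completions {c ℓ : Level} (R : CommutativeRing c ℓ)
  (a b c' d : ℕ → ℕ → CommutativeRing.Carrier R) (e f : ℕ → CommutativeRing.Carrier R) where
  open CommutativeRing R hiding (zero)
  open FiniteSums R
  open Subsets R
  open import Relation.Binary.Reasoning.Setoid setoid

  A B C D E F : ℕ → Carrier
  A = diagSum R a
  B = diagSum R b
  C = diagSum R c'
  D = diagSum R d
  E h = e h + C h
  F h = f h + D h

  open PathSum R A B E F public

  diagSum-∑ : ∀ x k → diagSum R x k ≡ ∑ k (λ ξ → x (k ∸ 1 ∸ ξ) ξ)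
  diagSum-∑ x k = sumR-upTo k (λ ξ → x (k ∸ 1 ∸ ξ) ξ) id

  -- Total weight of the ways to fill the last k positions of a word, when S ⊆ {m - k + 1, …, m} is
  -- the set of large values already used and h is the number of values ≤ m - k still unused.
  completions     : ∀ k → Vec Bool k → ℕ → Carrier
  completionsStep : Bool → Bool → ∀ k → Vec Bool k → ℕ → Carrier

  completions zero    []      h = 1#
  completions (suc k) (s ∷ S) h = completionsStep (isEven k) s k S h

  -- The position is `m - k`; the flags are its parity and whether its own value is in the set. In
  -- order, the clauses are cycle peaks; even fixed points and cycle double falls; cycle double
  -- rises; odd fixed points and cycle valleys. Lower letters appear already summed, as `B h` and
  -- `C h`.
  completionsStep true  true  k S h = B h * completions k S (h ∸ 1)
  completionsStep true  false k S h = (e (ones S) + C h) * completions k S h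
  completionsStep false true  k S h = sumOutside S (λ l r S′ → d l r * completions k S′ h)
  completionsStep false false k S h =
    f (ones S) * completions k S h + sumOutside S (λ l r S′ → a l r * completions k S′ (suc h))

  -- After the exchange of pairs, `G` no longer depends on `v`, and for fixed `S′` the rank of `v`
  -- takes each value once. The factor therefore depends only on the size of `S′`.
  sumSub-weighted : ∀ k h x (G : Vec Bool k → Carrier) →
    sumSub k h (λ S → sumOutside S (λ l r S′ → x l r * G S′)) ≈ diagSum R x (suc h) * sumSub k (suc h) G
  sumSub-weighted k h x G = begin
    sumSub k h (λ S → sumOutside S (λ l r S′ → x l r * G S′))
      ≈⟨ sumSub-sumOutside k h _ ⟩
    sumSub k (suc h) (λ S → sumInside S (λ l r S′ → x l r * G S′))
      ≈⟨ sumSub-cong k (suc h) (λ S S≡ → begin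
           sumInside S (λ l r S′ → x l r * G S′)
             ≈⟨ sumInside-∑ S _ ⟩
           ∑ (ones S) (λ t → x t (ones S ∸ 1 ∸ t) * G S)
             ≈⟨ ∑-*ʳ (ones S) (G S) (λ t → x t (ones S ∸ 1 ∸ t)) ⟩
           ∑ (ones S) (λ t → x t (ones S ∸ 1 ∸ t)) * G S
             ≈⟨ *-congʳ (∑-reverse (ones S) x) ⟨
           ∑ (ones S) (λ t → x (ones S ∸ 1 ∸ t) t) * G S
             ≈⟨ *-congʳ (reflexive (≡.trans (≡.sym (diagSum-∑ x (ones S))) (cong (diagSum R x) S≡))) ⟩
           diagSum R x (suc h) * G S ∎) ⟩
    sumSub k (suc h) (λ S → diagSum R x (suc h) * G S)
      ≈⟨ sumSub-*ˡ k (suc h) _ G ⟩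
    diagSum R x (suc h) * sumSub k (suc h) G ∎

  -- At size `h` the fixed-point weight `e (ones S)` becomes `e h` and joins `C h` in `E h`.
  -- Likewise `f h` joins `D h` in `F h`; the `D` term comes from the sets that contain the next
  -- value, the `f` term from those that do not.
  sumSub-completions : ∀ k h → sumSub k h (λ S → completions k S h) ≈ pathSum k h
  sumSub-completions zero    zero    = refl
  sumSub-completions zero    (suc h) = refl
  sumSub-completions (suc k) zero with isEven k
  ... | false = begin
    sumSub k 0 (λ S → f (ones S) * completions k S 0 + sumOutside S (λ l r S′ → a l r * completions k S′ 1))
      ≈⟨ sumSub-+ k 0 _ _ ⟩
    sumSub k 0 (λ S → f (ones S) * completions k S 0)
    + sumSub k 0 (λ S → sumOutside S (λ l r S′ → a l r * completions k S′ 1))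
      ≈⟨ +-cong (trans (sumSub-cong k 0 λ S S≡ → *-congʳ (trans (reflexive (cong f S≡)) (sym (+-identityʳ _))))
                  (trans (sumSub-*ˡ k 0 _ _) (*-congˡ (sumSub-completions k 0))))
                (trans (sumSub-weighted k 0 a _) (*-congˡ (sumSub-completions k 1))) ⟩
    F 0 * pathSum k 0 + A 1 * pathSum k 1 ∎
  ... | true = begin
    sumSub k 0 (λ S → (e (ones S) + C 0) * completions k S 0)
      ≈⟨ trans (sumSub-cong k 0 λ S S≡ → *-congʳ (+-congʳ (reflexive (cong e S≡))))
               (trans (sumSub-*ˡ k 0 _ _) (*-congˡ (sumSub-completions k 0))) ⟩
    E 0 * pathSum k 0
      ≈⟨ +-identityʳ _ ⟨
    E 0 * pathSum k 0 + 0#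
      -- `B 0` is an empty sum, which supplies the down step that `pathSum` lists at height `0`.
      ≈⟨ +-congˡ (zeroˡ _) ⟨
    E 0 * pathSum k 0 + B 0 * pathSum k 0 ∎
  sumSub-completions (suc k) (suc h) with isEven k
  ... | true = begin
    sumSub k h (λ S → B (suc h) * completions k S h)
    + sumSub k (suc h) (λ S → (e (ones S) + C (suc h)) * completions k S (suc h))
      ≈⟨ +-cong (trans (sumSub-*ˡ k h _ _) (*-congˡ (sumSub-completions k h)))
                (trans (sumSub-cong k (suc h) λ S S≡ → *-congʳ (+-congʳ (reflexive (cong e S≡))))
                  (trans (sumSub-*ˡ k (suc h) _ _) (*-congˡ (sumSub-completions k (suc h))))) ⟩
    B (suc h) * pathSum k h + E (suc h) * pathSum k (suc h)
      ≈⟨ +-comm _ _ ⟩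
    E (suc h) * pathSum k (suc h) + B (suc h) * pathSum k h ∎
  ... | false = begin
    sumSub k h (λ S → sumOutside S (λ l r S′ → d l r * completions k S′ (suc h)))
    + sumSub k (suc h) (λ S → f (ones S) * completions k S (suc h)
                              + sumOutside S (λ l r S′ → a l r * completions k S′ (2 N.+ h)))
      ≈⟨ +-cong (trans (sumSub-weighted k h d _) (*-congˡ (sumSub-completions k (suc h))))
                (sumSub-+ k (suc h) _ _) ⟩
    D (suc h) * pathSum k (suc h)
    + (sumSub k (suc h) (λ S → f (ones S) * completions k S (suc h))
       + sumSub k (suc h) (λ S → sumOutside S (λ l r S′ → a l r * completions k S′ (2 N.+ h))))
      ≈⟨ +-congˡ (+-cong
           (trans (sumSub-cong k (suc h) λ S S≡ → *-congʳ (reflexive (cong f S≡)))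
             (trans (sumSub-*ˡ k (suc h) _ _) (*-congˡ (sumSub-completions k (suc h)))))
           (trans (sumSub-weighted k (suc h) a _) (*-congˡ (sumSub-completions k (2 N.+ h))))) ⟩
    D (suc h) * pathSum k (suc h)
    + (f (suc h) * pathSum k (suc h) + A (2 N.+ h) * pathSum k (2 N.+ h))
      ≈⟨ +-assoc _ _ _ ⟨
    D (suc h) * pathSum k (suc h) + f (suc h) * pathSum k (suc h) + A (2 N.+ h) * pathSum k (2 N.+ h)
      ≈⟨ +-congʳ (trans (+-comm _ _) (sym (distribʳ _ _ _))) ⟩
    F (suc h) * pathSum k (suc h) + A (2 N.+ h) * pathSum k (2 N.+ h) ∎

-- The set and the height read off a prefix.

insert : ℕ → (ℕ → Bool) → ℕ → Bool
insert x q v = (v ≡ᵇ x) ∨ q v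

window : ∀ k → ℕ → (ℕ → Bool) → Vec Bool k
window zero    o q = []
window (suc k) o q = q (suc o) ∷ window k (suc o) q

window-cong : ∀ k o {q r : ℕ → Bool} → (∀ v → o < v → q v ≡ r v) → window k o q ≡ window k o r
window-cong zero    o eq = ≡.refl
window-cong (suc k) o eq = cong₂ _∷_ (eq (suc o) ℕₚ.≤-refl) (window-cong k (suc o) λ v o<v → eq v (ℕₚ.<⇒≤ o<v))

ones-window : ∀ k o q → ones (window k o q) ≡ countFrom o k q
ones-window zero    o q = ≡.refl
ones-window (suc k) o q = cong (bit (q (suc o)) N.+_) (ones-window k (suc o) q)

used-∷ : ∀ x p v → used (x ∷ p) v ≡ insert x (used p) v
used-∷ x p v with v ≡ᵇ x
... | true  = ≡.refl
... | false = ≡.refl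

used-∷-≢ : ∀ {x} p {v} → v ≢ x → used (x ∷ p) v ≡ used p v
used-∷-≢ p {v} v≢x = cong (λ b → not (not b ∧ notIn v p)) (≡ᵇ-false v≢x)

notIn-∷-≢ : ∀ {x} p {v} → v ≢ x → notIn v (x ∷ p) ≡ notIn v p
notIn-∷-≢ p {v} v≢x = cong (λ b → not b ∧ notIn v p) (≡ᵇ-false v≢x)

notIn-∷-self : ∀ x p → notIn x (x ∷ p) ≡ false
notIn-∷-self x p = cong (λ b → not b ∧ notIn x p) (≡ᵇ-refl x)

insert-self : ∀ x q → insert x q x ≡ true
insert-self x q = cong (_∨ q x) (≡ᵇ-refl x)

insert-≢ : ∀ {x} q {v} → v ≢ x → insert x q v ≡ q v
insert-≢ q {v} v≢x = cong (_∨ q v) (≡ᵇ-false v≢x)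

countFrom-last : ∀ k q → countFrom 0 (suc k) q ≡ countFrom 0 k q N.+ bit (q (suc k))
countFrom-last k q = ≡.trans (cong (λ n → countFrom 0 n q) (ℕₚ.+-comm 1 k))
  (≡.trans (countFrom-split 0 k 1 q) (cong (countFrom 0 k q N.+_) (ℕₚ.+-identityʳ (bit (q (suc k))))))

isEven-+ : ∀ j k → isEven (j N.+ k) ≡ true → isEven j ≡ isEven k
isEven-+ zero          k ev = ≡.sym ev
isEven-+ (suc zero)    (suc zero)    ev = ≡.refl
isEven-+ (suc zero)    (suc (suc k)) ev = isEven-+ 1 k ev
isEven-+ (suc (suc j)) k ev = isEven-+ j k ev

allowed-even : ∀ i x → isEven i ≡ true → allowed i x ≡ (x ≤ᵇ i)
allowed-even i x = cong (if_then x ≤ᵇ i else (i ≤ᵇ x))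

allowed-odd : ∀ i x → isEven i ≡ false → allowed i x ≡ (i ≤ᵇ x)
allowed-odd i x = cong (if_then x ≤ᵇ i else (i ≤ᵇ x))

allowed-self : ∀ i → allowed i i ≡ true
allowed-self i with isEven i
... | true  = ≤ᵇ-true (ℕₚ.≤-refl {i})
... | false = ≤ᵇ-true (ℕₚ.≤-refl {i})

-- The height `h` of `completions`. Reading a letter also raises the threshold from `length p` by
-- one; this is the source of the term `bit (notIn (suc (length p)) p)` in its updates.
unusedSmall : List ℕ → ℕ
unusedSmall p = countFrom 0 (length p) (λ v → notIn v p)

unusedSmall-fix : ∀ p → unusedSmall (suc (length p) ∷ p) ≡ unusedSmall p
unusedSmall-fix p = ≡.trans (countFrom-last j _)
  (≡.trans (cong₂ N._+_ (countFrom-cong 0 j λ v _ v≤j → notIn-∷-≢ p (ℕₚ.<⇒≢ (s≤s v≤j)))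
                        (cong bit (notIn-∷-self (suc j) p)))
           (ℕₚ.+-identityʳ _))
  where j = length p

unusedSmall-up : ∀ p x → suc (length p) < x → unusedSmall (x ∷ p) ≡ unusedSmall p N.+ bit (notIn (suc (length p)) p)
unusedSmall-up p x i<x = ≡.trans (countFrom-last j _)
  (cong₂ N._+_ (countFrom-cong 0 j λ v _ v≤j → notIn-∷-≢ p (ℕₚ.<⇒≢ (ℕₚ.≤-<-trans v≤j (ℕₚ.<⇒≤ i<x))))
               (cong bit (notIn-∷-≢ p (ℕₚ.<⇒≢ i<x))))
  where j = length p

unusedSmall-down : ∀ p x → 0 < x → x ≤ length p → notIn x p ≡ true →
               unusedSmall (x ∷ p) ≡ unusedSmall p ∸ 1 N.+ bit (notIn (suc (length p)) p)
unusedSmall-down p x 0<x x≤j x∉p = ≡.trans (countFrom-last j _)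
  (cong₂ N._+_
    (cong (_∸ 1) (≡.sym (≡.trans
      (countFrom-insert {q = λ v → notIn v (x ∷ p)} {r = λ v → notIn v p} 0<x x≤j
        (notIn-∷-self x p) (λ v v≢x → ≡.sym (notIn-∷-≢ p v≢x)))
      (cong (λ b → bit b N.+ countFrom 0 j (λ v → notIn v (x ∷ p))) x∉p))))
    (cong bit (notIn-∷-≢ p (ℕₚ.>⇒≢ (s≤s x≤j)))))
  where j = length p

-- Scanning words: only the set and the height matter.

module Scan {c ℓ : Level} (R : CommutativeRing c ℓ)
  (a b c' d : ℕ → ℕ → CommutativeRing.Carrier R) (e f : ℕ → CommutativeRing.Carrier R) where
  open CommutativeRing R hiding (zero)
  open FiniteSums R
  open Subsets R
  open Completions R a b c' d e f
  open import Relation.Binary.Reasoning.Setoid setoid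

  guard : ∀ {p q} {x y : Carrier} → q ≡ true → (p ≡ true → x ≈ y) →
          (if p ∧ q then x else 0#) ≈ (if p then y else 0#)
  guard {true}  ≡.refl eq = eq ≡.refl
  guard {false} _      _  = refl

  guard-false : ∀ p {q} {x : Carrier} → q ≡ false → (if p ∧ q then x else 0#) ≈ 0#
  guard-false true  ≡.refl = refl
  guard-false false _      = refl

  if-*ʳ : ∀ p {x y : Carrier} → (if p then x * y else 0#) ≈ (if p then x else 0#) * y
  if-*ʳ true  = refl
  if-*ʳ false = sym (zeroˡ _)

  if-not : ∀ p {x y : Carrier} → (if p then x else y) ≡ (if not p then y else x)
  if-not true  = ≡.refl
  if-not false = ≡.refl

  -- Here and below, p lists the letters read so far in reverse order and x comes next.
  letterWeight : ℕ → List ℕ → ℕ → Carrier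
  letterWeight m p x =
    if x <ᵇ i then (if notIn i p then c' else b) (countFrom x (length p ∸ x) (λ v → notIn v p))
                                                 (countFrom 0 (x ∸ 1) (λ v → notIn v p))
    else if i <ᵇ x then (if notIn i p then a else d) (countFrom i (x ∸ suc i) (used p))
                                                     (countFrom x (m ∸ x) (used p))
    else (if isEven i then e else f) (countFrom i (m ∸ i) (used p))
    where i = suc (length p)

  letterWeight-lower : ∀ m p x → x < suc (length p) → letterWeight m p x ≡
    (if notIn (suc (length p)) p then c' else b) (countFrom x (length p ∸ x) (λ v → notIn v p))
                                                 (countFrom 0 (x ∸ 1) (λ v → notIn v p))
  letterWeight-lower m p x x<i rewrite <ᵇ-true x<i = ≡.refl

  letterWeight-upper : ∀ m p x → suc (length p) < x → letterWeight m p x ≡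
    (if notIn (suc (length p)) p then a else d) (countFrom (suc (length p)) (x ∸ suc (suc (length p))) (used p))
                                                (countFrom x (m ∸ x) (used p))
  letterWeight-upper m p x i<x rewrite <ᵇ-false (ℕₚ.<⇒≤ i<x) | <ᵇ-true i<x = ≡.refl

  letterWeight-fixed : ∀ m p → letterWeight m p (suc (length p)) ≡
    (if isEven (suc (length p)) then e else f) (countFrom (suc (length p)) (m ∸ suc (length p)) (used p))
  letterWeight-fixed m p rewrite <ᵇ-false (ℕₚ.≤-refl {length p}) = ≡.refl

  extensions : ℕ → ℕ → List ℕ → Carrier
  extensions m zero    p = 1#
  extensions m (suc k) p = ∑ m λ t →
    if notIn (suc t) p ∧ allowed (suc (length p)) (suc t)
    then letterWeight m p (suc t) * extensions m k (suc t ∷ p) else 0#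

  -- Only values selected by `q` contribute, and in increasing order the number of selected values
  -- below them is 0, 1, 2, and so on. `z` accumulates the selected values already passed.
  ∑-rank : ∀ j o z (q : ℕ → Bool) (g : ℕ → ℕ → Carrier) →
    ∑ j (λ t → if q (suc (o N.+ t)) then g (countFrom (suc (o N.+ t)) (j ∸ suc t) q) (z N.+ countFrom o t q) else 0#)
    ≈ ∑ (countFrom o j q) (λ ξ → g (countFrom o j q ∸ 1 ∸ ξ) (z N.+ ξ))
  ∑-rank zero    o z q g = refl
  ∑-rank (suc j) o z q g = begin
    (if q (suc (o N.+ 0)) then g (countFrom (suc (o N.+ 0)) j q) (z N.+ 0) else 0#)
    + ∑ j (λ t → if q (suc (o N.+ suc t)) then g (countFrom (suc (o N.+ suc t)) (j ∸ suc t) q)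
                                                 (z N.+ (bit (q (suc o)) N.+ countFrom (suc o) t q)) else 0#)
      ≈⟨ +-cong (reflexive (cong (λ n → if q (suc n) then g (countFrom (suc n) j q) (z N.+ 0) else 0#) (ℕₚ.+-identityʳ o)))
                (∑-cong j λ t _ → reflexive (cong₂ (λ n l → if q (suc n) then g (countFrom (suc n) (j ∸ suc t) q) l else 0#)
                   (ℕₚ.+-suc o t) (≡.sym (ℕₚ.+-assoc z (bit (q (suc o))) _)))) ⟩
    (if q (suc o) then g (countFrom (suc o) j q) (z N.+ 0) else 0#)
    + ∑ j (λ t → if q (suc (suc o N.+ t)) then g (countFrom (suc (suc o N.+ t)) (j ∸ suc t) q)
                                                 (z N.+ bit (q (suc o)) N.+ countFrom (suc o) t q) else 0#)
      ≈⟨ +-congˡ (∑-rank j (suc o) (z N.+ bit (q (suc o))) q g) ⟩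
    (if q (suc o) then g n (z N.+ 0) else 0#) + ∑ n (λ ξ → g (n ∸ 1 ∸ ξ) (z N.+ bit (q (suc o)) N.+ ξ))
      ≈⟨ head (q (suc o)) ⟩
    ∑ (bit (q (suc o)) N.+ n) (λ ξ → g (bit (q (suc o)) N.+ n ∸ 1 ∸ ξ) (z N.+ ξ)) ∎
    where
    n = countFrom (suc o) j q
    head : ∀ s → (if s then g n (z N.+ 0) else 0#) + ∑ n (λ ξ → g (n ∸ 1 ∸ ξ) (z N.+ bit s N.+ ξ))
                 ≈ ∑ (bit s N.+ n) (λ ξ → g (bit s N.+ n ∸ 1 ∸ ξ) (z N.+ ξ))
    head true  = +-congˡ (∑-cong n λ ξ _ → reflexive (cong₂ g (ℕₚ.∸-+-assoc n 1 ξ) (ℕₚ.+-assoc z 1 ξ)))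
    head false = trans (+-identityˡ _) (∑-cong n λ ξ _ →
                   reflexive (cong (λ l → g (n ∸ 1 ∸ ξ) (l N.+ ξ)) (ℕₚ.+-identityʳ z)))

  ∑-rank-diagSum : ∀ j (q : ℕ → Bool) (g : ℕ → ℕ → Carrier) →
    ∑ j (λ t → if q (suc t) then g (countFrom (suc t) (j ∸ suc t) q) (countFrom 0 t q) else 0#)
    ≈ diagSum R g (countFrom 0 j q)
  ∑-rank-diagSum j q g = trans (∑-rank j 0 0 q g) (reflexive (≡.sym (diagSum-∑ g (countFrom 0 j q))))

  -- Peeling the first value of the window follows the recursion of `sumOutside`: either this value
  -- is the inserted one, or it keeps its bit and, if used, raises the lower rank of each later
  -- choice.
  sumOutside-window : ∀ k o (q : ℕ → Bool) (K : ℕ → ℕ → Vec Bool k → Carrier) →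
    ∑ k (λ t → if q (suc (o N.+ t)) then 0# else
                 K (countFrom o t q) (countFrom (suc (o N.+ t)) (k ∸ suc t) q) (window k o (insert (suc (o N.+ t)) q)))
    ≈ sumOutside (window k o q) K
  sumOutside-window zero    o q K = refl
  sumOutside-window (suc k) o q K = +-cong
    (trans (reflexive (cong (λ n → if q (suc n) then 0# else
              K 0 (countFrom (suc n) k q) (insert (suc n) q (suc o) ∷ window k (suc o) (insert (suc n) q)))
              (ℕₚ.+-identityʳ o)))
           (reflexive (cong₂ (λ n S → if q (suc o) then 0# else K 0 n S)
             (≡.sym (ones-window k (suc o) q))
             (cong₂ _∷_ (insert-self (suc o) q) (window-cong k (suc o) λ v o<v → insert-≢ q (ℕₚ.>⇒≢ o<v))))))
    (trans (∑-cong k λ t _ → reflexive (≡.trans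
              (cong (λ n → if q (suc n) then 0# else
                K (bit (q (suc o)) N.+ countFrom (suc o) t q) (countFrom (suc n) (k ∸ suc t) q)
                  (insert (suc n) q (suc o) ∷ window k (suc o) (insert (suc n) q))) (ℕₚ.+-suc o t))
              (cong (λ s → if q (suc (suc o N.+ t)) then 0# else
                K (bit (q (suc o)) N.+ countFrom (suc o) t q) (countFrom (suc (suc o N.+ t)) (k ∸ suc t) q)
                  (s ∷ window k (suc o) (insert (suc (suc o N.+ t)) q)))
                (insert-≢ q (ℕₚ.<⇒≢ (s≤s (s≤s (ℕₚ.m≤m+n o t))))))))
           (sumOutside-window k (suc o) q (λ l r S → K (bit (q (suc o)) N.+ l) r (q (suc o) ∷ S))))

  ∑-around : ∀ j k (g : ℕ → Carrier) →
    ∑ (j N.+ suc k) (g ∘ suc) ≈ ∑ j (g ∘ suc) + (g (suc j) + ∑ k (λ t → g (suc (suc j N.+ t))))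
  ∑-around j k g = trans (∑-split j (suc k) (g ∘ suc)) (+-congˡ (+-cong
    (reflexive (cong (g ∘ suc) (ℕₚ.+-identityʳ j)))
    (∑-cong k λ t _ → reflexive (cong (g ∘ suc) (ℕₚ.+-suc j t)))))

  -- The next letter is split at the diagonal and parity closes one side. Since `m` is even, the
  -- position `i` and the number `k` of letters after it have the same parity, which is what
  -- `completions` tests.
  extensions-completions : ∀ m → isEven m ≡ true → ∀ k p → length p N.+ k ≡ m →
    extensions m k p ≈ completions k (window k (length p) (used p)) (unusedSmall p)
  extensions-completions m m-even zero    p _  = refl
  extensions-completions m m-even (suc k) p ≡.refl = begin
    ∑ (j N.+ suc k) (term ∘ suc)
      ≈⟨ ∑-around j k term ⟩
    ∑ j (term ∘ suc) + (term i + ∑ k (λ t → term (suc (i N.+ t))))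
      ≈⟨ step ⟩
    completions (suc k) (used p i ∷ S) H ∎
    where
    j i H : ℕ
    j = length p
    i = suc j
    H = unusedSmall p
    S = window k i (used p)
    term : ℕ → Carrier
    term x = if notIn x p ∧ allowed i x then letterWeight m p x * extensions m k (x ∷ p) else 0#

    IH : ∀ x → extensions m k (x ∷ p) ≈ completions k (window k i (used (x ∷ p))) (unusedSmall (x ∷ p))
    IH x = extensions-completions m m-even k (x ∷ p) (≡.sym (ℕₚ.+-suc j k))

    parity : isEven i ≡ isEven k
    parity = isEven-+ i k (≡.trans (cong isEven (≡.sym (ℕₚ.+-suc j k))) m-even)

    IH-lower : ∀ x → 0 < x → x ≤ j → notIn x p ≡ true →
               extensions m k (x ∷ p) ≈ completions k S (H ∸ 1 N.+ bit (notIn i p))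
    IH-lower x 0<x x≤j x∉p = trans (IH x) (reflexive (cong₂ (completions k)
      (window-cong k i λ v i<v → used-∷-≢ p (ℕₚ.>⇒≢ (ℕₚ.≤-<-trans x≤j (ℕₚ.<⇒≤ i<v))))
      (unusedSmall-down p x 0<x x≤j x∉p)))

    IH-fixed : extensions m k (i ∷ p) ≈ completions k S H
    IH-fixed = trans (IH i) (reflexive (cong₂ (completions k)
      (window-cong k i λ v i<v → used-∷-≢ p (ℕₚ.>⇒≢ i<v)) (unusedSmall-fix p)))

    IH-upper : ∀ x → i < x →
      extensions m k (x ∷ p) ≈ completions k (window k i (insert x (used p))) (H N.+ bit (notIn i p))
    IH-upper x i<x = trans (IH x) (reflexive (cong₂ (completions k)
      (window-cong k i λ v _ → used-∷ x p v) (unusedSmall-up p x i<x)))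

    fixed : ∀ s → notIn i p ≡ s → ∀ ev → isEven i ≡ ev →
            term i ≈ (if s then (if ev then e else f) (ones S) * completions k S H else 0#)
    fixed _ ≡.refl _ ≡.refl = guard (allowed-self i) λ _ →
      *-cong (reflexive (≡.trans (letterWeight-fixed m p) (cong (if isEven i then e else f)
                (≡.trans (cong (λ n → countFrom i n (used p)) m∸i≡k) (≡.sym (ones-window k i (used p)))))))
             IH-fixed
      where
      m∸i≡k : m ∸ i ≡ k
      m∸i≡k = ≡.trans (cong (_∸ i) (ℕₚ.+-suc j k)) (ℕₚ.m+n∸m≡n i k)

    -- The window lies above every small value, and the new height is the same whichever one is
    -- taken. So the remaining weight `Y` factors out and the ranks sum to a `diagSum`.
    lower-even : isEven i ≡ true → ∀ s → notIn i p ≡ s → ∑ j (term ∘ suc) ≈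
      diagSum R (if s then c' else b) H * completions k S (H ∸ 1 N.+ bit s)
    lower-even ev _ ≡.refl = begin
      ∑ j (term ∘ suc)
        ≈⟨ ∑-cong j (λ t t<j → trans
             (guard (≡.trans (allowed-even i (suc t) ev) (≤ᵇ-true (ℕₚ.<⇒≤ (s≤s t<j)))) λ t∉p →
               *-cong (reflexive (letterWeight-lower m p (suc t) (s≤s t<j))) (IH-lower (suc t) (s≤s z≤n) t<j t∉p))
             (if-*ʳ (free (suc t)))) ⟩
      ∑ j (λ t → (if free (suc t) then g (countFrom (suc t) (j ∸ suc t) free) (countFrom 0 t free) else 0#) * Y)
        ≈⟨ ∑-*ʳ j Y _ ⟩
      ∑ j (λ t → if free (suc t) then g (countFrom (suc t) (j ∸ suc t) free) (countFrom 0 t free) else 0#) * Y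
        ≈⟨ *-congʳ (∑-rank-diagSum j free g) ⟩
      diagSum R g H * Y ∎
      where
      g = if notIn i p then c' else b
      Y = completions k S (H ∸ 1 N.+ bit (notIn i p))
      free : ℕ → Bool
      free v = notIn v p

    lower-odd : isEven i ≡ false → ∑ j (term ∘ suc) ≈ 0#
    lower-odd od = ∑-zero j λ t t<j →
      guard-false (notIn (suc t) p) (≡.trans (allowed-odd i (suc t) od) (≤ᵇ-false (s≤s t<j)))

    upper-even : isEven i ≡ true → ∑ k (λ t → term (suc (i N.+ t))) ≈ 0#
    upper-even ev = ∑-zero k λ t _ →
      guard-false (notIn (suc (i N.+ t)) p)
        (≡.trans (allowed-even i (suc (i N.+ t)) ev) (≤ᵇ-false (s≤s (ℕₚ.m≤m+n i t))))

    -- The inserted value changes the window, so no factor comes out here; the sum is only recast as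
    -- a `sumOutside`.
    upper-odd : isEven i ≡ false → ∀ s → notIn i p ≡ s → ∑ k (λ t → term (suc (i N.+ t))) ≈
      sumOutside S (λ l r S′ → (if s then a else d) l r * completions k S′ (H N.+ bit s))
    upper-odd od _ ≡.refl = trans
      (∑-cong k λ t _ → trans
        (guard (≡.trans (allowed-odd i (suc (i N.+ t)) od) (≤ᵇ-true (ℕₚ.m≤n⇒m≤1+n (ℕₚ.m≤m+n i t)))) λ _ →
          *-cong (reflexive (≡.trans (letterWeight-upper m p (suc (i N.+ t)) (s≤s (ℕₚ.m≤m+n i t)))
                    (cong₂ (λ y z → g (countFrom i y (used p)) (countFrom (suc (i N.+ t)) z (used p)))
                      (ℕₚ.m+n∸m≡n i t) (m∸x t))))
                 (IH-upper (suc (i N.+ t)) (s≤s (ℕₚ.m≤m+n i t))))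
        (reflexive (if-not (notIn (suc (i N.+ t)) p))))
      (sumOutside-window k i (used p) (λ l r S′ → g l r * completions k S′ (H N.+ bit (notIn i p))))
      where
      g = if notIn i p then a else d
      m∸x : ∀ t → m ∸ suc (i N.+ t) ≡ k ∸ suc t
      m∸x t = ≡.trans (cong₂ _∸_ (ℕₚ.+-suc j k) (≡.sym (ℕₚ.+-suc i t))) (ℕₚ.[m+n]∸[m+o]≡n∸o i k (suc t))

    total = ∑ j (term ∘ suc) + (term i + ∑ k (λ t → term (suc (i N.+ t))))

    -- The truncation H ∸ 1 is harmless because the coefficient vanishes when H = 0.
    C-restore : ∀ H → C H * completions k S (H ∸ 1 N.+ 1) ≈ C H * completions k S H
    C-restore zero    = trans (zeroˡ _) (sym (zeroˡ _))
    C-restore (suc H) = *-congˡ (reflexive (cong (completions k S) (ℕₚ.+-comm H 1)))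

    step-at : ∀ ev → isEven i ≡ ev → ∀ s → notIn i p ≡ s → total ≈ completionsStep ev (not s) k S H
    step-at true ev true i∉p = begin
      total
        ≈⟨ +-cong (lower-even ev true i∉p) (+-cong (fixed true i∉p true ev) (upper-even ev)) ⟩
      C H * completions k S (H ∸ 1 N.+ 1) + (e (ones S) * completions k S H + 0#)
        ≈⟨ +-cong (C-restore H) (+-identityʳ _) ⟩
      C H * completions k S H + e (ones S) * completions k S H
        ≈⟨ trans (+-comm _ _) (sym (distribʳ _ _ _)) ⟩
      (e (ones S) + C H) * completions k S H ∎
    step-at true ev false i∈p = begin
      total
        ≈⟨ +-cong (lower-even ev false i∈p) (+-cong (fixed false i∈p true ev) (upper-even ev)) ⟩
      B H * completions k S (H ∸ 1 N.+ 0) + (0# + 0#)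
        ≈⟨ trans (+-congˡ (+-identityˡ 0#)) (+-identityʳ _) ⟩
      B H * completions k S (H ∸ 1 N.+ 0)
        ≈⟨ *-congˡ (reflexive (cong (completions k S) (ℕₚ.+-identityʳ (H ∸ 1)))) ⟩
      B H * completions k S (H ∸ 1) ∎
    step-at false od true i∉p = begin
      total
        ≈⟨ +-cong (lower-odd od) (+-cong (fixed true i∉p false od) (upper-odd od true i∉p)) ⟩
      0# + (f (ones S) * completions k S H + sumOutside S (λ l r S′ → a l r * completions k S′ (H N.+ 1)))
        ≈⟨ +-identityˡ _ ⟩
      f (ones S) * completions k S H + sumOutside S (λ l r S′ → a l r * completions k S′ (H N.+ 1))
        ≈⟨ +-congˡ (reflexive (cong (λ h → sumOutside S (λ l r S′ → a l r * completions k S′ h)) (ℕₚ.+-comm H 1))) ⟩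
      f (ones S) * completions k S H + sumOutside S (λ l r S′ → a l r * completions k S′ (suc H)) ∎
    step-at false od false i∈p = begin
      total
        ≈⟨ +-cong (lower-odd od) (+-cong (fixed false i∈p false od) (upper-odd od false i∈p)) ⟩
      0# + (0# + sumOutside S (λ l r S′ → d l r * completions k S′ (H N.+ 0)))
        ≈⟨ trans (+-identityˡ _) (+-identityˡ _) ⟩
      sumOutside S (λ l r S′ → d l r * completions k S′ (H N.+ 0))
        ≈⟨ reflexive (cong (λ h → sumOutside S (λ l r S′ → d l r * completions k S′ h)) (ℕₚ.+-identityʳ H)) ⟩
      sumOutside S (λ l r S′ → d l r * completions k S′ H) ∎

    step : total ≈ completions (suc k) (used p i ∷ S) H
    step = step-at (isEven k) parity (notIn i p) ≡.refl

-- From the sum over permutations to the scan.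

allWords-within : ∀ m k → All (λ s → length s ≡ k × All (Within m) s) (allWords m k)
allWords-within m zero    = (≡.refl , []) ∷ []
allWords-within m (suc k) = Allₚ.concat⁺ (Allₚ.map⁺ (Allₚ.map⁺ (Allₚ.applyUpTo⁺₁ id m λ t<m →
  Allₚ.map⁺ (All.map (λ { (len , within) → cong suc len , (s≤s z≤n , t<m) ∷ within }) (allWords-within m k)))))

module WeightSum {c ℓ : Level} (R : CommutativeRing c ℓ)
  (a b c' d : ℕ → ℕ → CommutativeRing.Carrier R) (e f : ℕ → CommutativeRing.Carrier R) where
  open CommutativeRing R hiding (zero)
  open FiniteSums R
  open Subsets R
  open Completions R a b c' d e f
  open Scan R a b c' d e f
  open import Algebra.Properties.CommutativeSemigroup *-commutativeSemigroup
    using (interchange)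
  open import Relation.Binary.Reasoning.Setoid setoid

  sumOver : ∀ {X : Set} → (X → Carrier) → List X → Carrier
  sumOver F xs = sumR R (map F xs)

  sumOver-++ : ∀ {X : Set} (F : X → Carrier) xs ys → sumOver F (xs ++ ys) ≈ sumOver F xs + sumOver F ys
  sumOver-++ F []       ys = sym (+-identityˡ _)
  sumOver-++ F (x ∷ xs) ys = trans (+-congˡ (sumOver-++ F xs ys)) (sym (+-assoc _ _ _))

  sumOver-cong : ∀ {X : Set} {F G : X → Carrier} {xs} → All (λ x → F x ≈ G x) xs → sumOver F xs ≈ sumOver G xs
  sumOver-cong []         = refl
  sumOver-cong (eq ∷ eqs) = +-cong eq (sumOver-cong eqs)

  sumOver-*ˡ : ∀ {X : Set} y (F : X → Carrier) xs → sumOver (λ x → y * F x) xs ≈ y * sumOver F xs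
  sumOver-*ˡ y F []       = sym (zeroʳ y)
  sumOver-*ˡ y F (x ∷ xs) = trans (+-congˡ (sumOver-*ˡ y F xs)) (sym (distribˡ y _ _))

  sumOver-zero : ∀ {X : Set} (xs : List X) → sumOver (λ _ → 0#) xs ≈ 0#
  sumOver-zero []       = refl
  sumOver-zero (x ∷ xs) = trans (+-identityˡ _) (sumOver-zero xs)

  sumOver-guard : ∀ {X : Set} p y (F : X → Carrier) xs →
    sumOver (λ x → if p then y * F x else 0#) xs ≈ (if p then y * sumOver F xs else 0#)
  sumOver-guard true  y F xs = sumOver-*ˡ y F xs
  sumOver-guard false y F xs = sumOver-zero xs

  sumOver-filterᵇ : ∀ {X : Set} (p : X → Bool) (F : X → Carrier) xs →
    sumOver F (filterᵇ p xs) ≈ sumOver (λ x → if p x then F x else 0#) xs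
  sumOver-filterᵇ p F []       = refl
  sumOver-filterᵇ p F (x ∷ xs) with p x
  ... | true  = +-congˡ (sumOver-filterᵇ p F xs)
  ... | false = trans (sumOver-filterᵇ p F xs) (sym (+-identityˡ _))

  sumOver-concatMap-range : ∀ {X : Set} (F : X → Carrier) (g : ℕ → List X) n h →
    sumOver F (concatMap g (map suc (applyUpTo h n))) ≈ ∑ n (λ t → sumOver F (g (suc (h t))))
  sumOver-concatMap-range F g zero    h = refl
  sumOver-concatMap-range F g (suc n) h =
    trans (sumOver-++ F (g (suc (h 0))) _) (+-congˡ (sumOver-concatMap-range F g n (h ∘ suc)))

  -- Both filters, distinctness and the parity condition on letters, are absorbed as zeros, so the
  -- sum can run over all words and unfold letter by letter.
  wordWeight : ℕ → List ℕ → List ℕ → Carrier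
  wordWeight m p []      = 1#
  wordWeight m p (x ∷ s) =
    if notIn x p ∧ allowed (suc (length p)) x then letterWeight m p x * wordWeight m (x ∷ p) s else 0#

  sum-wordWeight : ∀ m k p → sumOver (wordWeight m p) (allWords m k) ≈ extensions m k p
  sum-wordWeight m zero    p = +-identityʳ 1#
  sum-wordWeight m (suc k) p = begin
    sumOver (wordWeight m p) (allWords m (suc k))
      ≈⟨ sumOver-concatMap-range (wordWeight m p) (λ x → map (x ∷_) (allWords m k)) m id ⟩
    ∑ m (λ t → sumOver (wordWeight m p) (map (suc t ∷_) (allWords m k)))
      ≈⟨ ∑-cong m (λ t _ → begin
           sumOver (wordWeight m p) (map (suc t ∷_) (allWords m k))
             ≈⟨ reflexive (cong (sumR R) (≡.sym (Listₚ.map-∘ (allWords m k)))) ⟩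
           sumOver (λ s → wordWeight m p (suc t ∷ s)) (allWords m k)
             ≈⟨ sumOver-guard (ok t) (letterWeight m p (suc t)) (wordWeight m (suc t ∷ p)) (allWords m k) ⟩
           (if ok t then letterWeight m p (suc t) * sumOver (wordWeight m (suc t ∷ p)) (allWords m k) else 0#)
             ≈⟨ if-congˡ (ok t) (*-congˡ (sum-wordWeight m k (suc t ∷ p))) ⟩
           (if ok t then letterWeight m p (suc t) * extensions m k (suc t ∷ p) else 0#) ∎) ⟩
    extensions m (suc k) p ∎
    where
    ok : ℕ → Bool
    ok t = notIn (suc t) p ∧ allowed (suc (length p)) (suc t)
    if-congˡ : ∀ p {x y : Carrier} → x ≈ y → (if p then x else 0#) ≈ (if p then y else 0#)
    if-congˡ true  eq = eq
    if-congˡ false _  = refl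

  wordWeight-invalid : ∀ m p s → freshAfter p s ∧ allAllowed (length p) s ≡ false → wordWeight m p s ≈ 0#
  wordWeight-invalid m p (x ∷ s) eq with notIn x p | allowed (suc (length p)) x
  ... | false | _     = refl
  ... | true  | false = refl
  ... | true  | true  = trans (*-congˡ (wordWeight-invalid m (x ∷ p) s eq)) (zeroʳ _)

  choose : Bool → Carrier → Carrier
  choose p y = if p then y else 1#

  choose-true : ∀ {p x} → p ≡ true → choose p x ≈ x
  choose-true ≡.refl = refl

  choose-false : ∀ {p x} → p ≡ false → choose p x ≈ 1#
  choose-false ≡.refl = refl

  drop : ∀ {x y z} → x ≈ 1# → y ≈ z → x * y ≈ z
  drop x≈1 y≈z = trans (*-cong x≈1 y≈z) (*-identityˡ _)

  keep : ∀ {x y z} → x ≈ z → y ≈ 1# → x * y ≈ z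
  keep x≈z y≈1 = trans (*-cong x≈z y≈1) (*-identityʳ _)

  -- With `1#` for an absent factor, six products over filtered positions merge into one product
  -- over all positions.
  positionWeight : ℕ → List ℕ → ℕ → Carrier
  positionWeight m w i =
      choose (isCval i)    (a  (ucross i) (unest i))
    * (choose (isCpeak i)  (b  (lcross i) (lnest i))
    * (choose (isCdfall i) (c' (lcross i) (lnest i))
    * (choose (isCdrise i) (d  (ucross i) (unest i))
    * (choose (isEvenfix i) (e (psnest i))
    *  choose (isOddfix i)  (f (psnest i))))))
    where open Stats m w

  -- Exactly one of the six classes contains `i`. It is found by comparing `x` with `i`, then off
  -- the diagonal by whether the value `i` has been read, and on the diagonal by parity; the other
  -- five factors are `1#`.
  letterWeight-positionWeight : ∀ p x s → All (Within (length (p ʳ++ x ∷ s))) (p ʳ++ x ∷ s) →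
    allDistinct (p ʳ++ x ∷ s) ≡ true →
    letterWeight (length (p ʳ++ x ∷ s)) p x ≈ positionWeight (length (p ʳ++ x ∷ s)) (p ʳ++ x ∷ s) (suc (length p))
  letterWeight-positionWeight p x s within distinct = compare (ℕₚ.<-cmp x i)
    where
    open Position p x s within distinct
    open Stats m w

    not-< : ∀ {v} → i ≤ v → ∀ y → (y ∧ (v <ᵇ i)) ≡ false
    not-< i≤v y = ≡.trans (cong (y ∧_) (<ᵇ-false i≤v)) (𝔹ₚ.∧-zeroʳ y)
    not-> : ∀ {v} → v ≤ i → ∀ y → (y ∧ (i <ᵇ v)) ≡ false
    not-> v≤i y = ≡.trans (cong (y ∧_) (<ᵇ-false v≤i)) (𝔹ₚ.∧-zeroʳ y)

    upper : i < σ i → ∀ z → notIn i p ≡ z →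
      (if z then a else d) (ucross i) (unest i) ≈ positionWeight m w i
    upper i<σ true i∉p = sym
      (keep (choose-true (cong₂ _∧_ (<ᵇ-true after) (<ᵇ-true i<σ)))
      (drop (choose-false (not-< (ℕₚ.<⇒≤ i<σ) (σ⁻¹ i <ᵇ i)))
      (drop (choose-false (not-< (ℕₚ.<⇒≤ i<σ) (i <ᵇ σ⁻¹ i)))
      (drop (choose-false (cong (_∧ (i <ᵇ σ i)) (<ᵇ-false (ℕₚ.<⇒≤ after))))
      (drop (choose-false (cong (_∧ isEven i) (≡ᵇ-false (ℕₚ.>⇒≢ i<σ))))
            (choose-false (cong (_∧ not (isEven i)) (≡ᵇ-false (ℕₚ.>⇒≢ i<σ)))))))))
      where after = σ⁻¹-after i∉p (λ x≡i → ℕₚ.>⇒≢ i<σ (≡.trans σi≡x x≡i))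
    upper i<σ false i∈p = sym
      (drop (choose-false (cong (_∧ (i <ᵇ σ i)) (<ᵇ-false (ℕₚ.<⇒≤ before))))
      (drop (choose-false (not-< (ℕₚ.<⇒≤ i<σ) (σ⁻¹ i <ᵇ i)))
      (drop (choose-false (not-< (ℕₚ.<⇒≤ i<σ) (i <ᵇ σ⁻¹ i)))
      (keep (choose-true (cong₂ _∧_ (<ᵇ-true before) (<ᵇ-true i<σ)))
      (drop (choose-false (cong (_∧ isEven i) (≡ᵇ-false (ℕₚ.>⇒≢ i<σ))))
            (choose-false (cong (_∧ not (isEven i)) (≡ᵇ-false (ℕₚ.>⇒≢ i<σ)))))))))
      where before = σ⁻¹-before i∈p

    lower : σ i < i → ∀ z → notIn i p ≡ z →
      (if z then c' else b) (lcross i) (lnest i) ≈ positionWeight m w i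
    lower σ<i true i∉p = sym
      (drop (choose-false (not-> (ℕₚ.<⇒≤ σ<i) (i <ᵇ σ⁻¹ i)))
      (drop (choose-false (cong (_∧ (σ i <ᵇ i)) (<ᵇ-false (ℕₚ.<⇒≤ after))))
      (keep (choose-true (cong₂ _∧_ (<ᵇ-true after) (<ᵇ-true σ<i)))
      (drop (choose-false (not-> (ℕₚ.<⇒≤ σ<i) (σ⁻¹ i <ᵇ i)))
      (drop (choose-false (cong (_∧ isEven i) (≡ᵇ-false (ℕₚ.<⇒≢ σ<i))))
            (choose-false (cong (_∧ not (isEven i)) (≡ᵇ-false (ℕₚ.<⇒≢ σ<i)))))))))
      where after = σ⁻¹-after i∉p (λ x≡i → ℕₚ.<⇒≢ σ<i (≡.trans σi≡x x≡i))
    lower σ<i false i∈p = sym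
      (drop (choose-false (not-> (ℕₚ.<⇒≤ σ<i) (i <ᵇ σ⁻¹ i)))
      (keep (choose-true (cong₂ _∧_ (<ᵇ-true before) (<ᵇ-true σ<i)))
      (drop (choose-false (cong (_∧ (σ i <ᵇ i)) (<ᵇ-false (ℕₚ.<⇒≤ before))))
      (drop (choose-false (not-> (ℕₚ.<⇒≤ σ<i) (σ⁻¹ i <ᵇ i)))
      (drop (choose-false (cong (_∧ isEven i) (≡ᵇ-false (ℕₚ.<⇒≢ σ<i))))
            (choose-false (cong (_∧ not (isEven i)) (≡ᵇ-false (ℕₚ.<⇒≢ σ<i)))))))))
      where before = σ⁻¹-before i∈p

    fixed : σ i ≡ i → ∀ z → isEven i ≡ z → (if z then e else f) (psnest i) ≈ positionWeight m w i
    fixed σ≡i z eq = sym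
      (drop (choose-false (not-> (ℕₚ.≤-reflexive σ≡i) (i <ᵇ σ⁻¹ i)))
      (drop (choose-false (not-< (ℕₚ.≤-reflexive (≡.sym σ≡i)) (σ⁻¹ i <ᵇ i)))
      (drop (choose-false (not-< (ℕₚ.≤-reflexive (≡.sym σ≡i)) (i <ᵇ σ⁻¹ i)))
      (drop (choose-false (not-> (ℕₚ.≤-reflexive σ≡i) (σ⁻¹ i <ᵇ i)))
            (parity z eq)))))
      where
      self : (σ i ≡ᵇ i) ≡ true
      self = ≡.trans (cong (_≡ᵇ i) σ≡i) (≡ᵇ-refl i)
      parity : ∀ z → isEven i ≡ z →
        choose (isEvenfix i) (e (psnest i)) * choose (isOddfix i) (f (psnest i)) ≈ (if z then e else f) (psnest i)
      parity true  ev = keep (choose-true (cong₂ _∧_ self ev)) (choose-false (cong₂ (λ y z → y ∧ not z) self ev))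
      parity false od = drop (choose-false (cong₂ _∧_ self od)) (choose-true (cong₂ (λ y z → y ∧ not z) self od))

    compare : _ → letterWeight m p x ≈ positionWeight m w i
    compare (tri< x<i _ _) = trans
      (reflexive (≡.trans (letterWeight-lower m p x x<i)
        (cong₂ (if notIn i p then c' else b) (≡.sym (lcross-i x<i)) (≡.sym (lnest-i x<i)))))
      (lower (≡.subst (_< i) (≡.sym σi≡x) x<i) (notIn i p) ≡.refl)
    compare (tri≈ _ ≡.refl _) = trans
      (reflexive (≡.trans (letterWeight-fixed m p) (cong (if isEven i then e else f) (≡.sym psnest-i))))
      (fixed σi≡x (isEven i) ≡.refl)
    compare (tri> _ _ i<x) = trans
      (reflexive (≡.trans (letterWeight-upper m p x i<x)
        (cong₂ (if notIn i p then a else d) (≡.sym (ucross-i i<x)) (≡.sym (unest-i i<x)))))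
      (upper (≡.subst (i <_) (≡.sym σi≡x) i<x) (notIn i p) ≡.refl)

  wordWeight-valid : ∀ p s → All (Within (length (p ʳ++ s))) (p ʳ++ s) → allDistinct (p ʳ++ s) ≡ true →
    freshAfter p s ∧ allAllowed (length p) s ≡ true →
    wordWeight (length (p ʳ++ s)) p s ≈
    posFold (λ i _ y → positionWeight (length (p ʳ++ s)) (p ʳ++ s) i * y) (length p) 1# s
  wordWeight-valid p []      within distinct ok = refl
  wordWeight-valid p (x ∷ s) within distinct ok = trans
    (if-true (cong₂ _∧_ (∧-trueˡ {notIn x p} fresh) (∧-trueˡ {allowed (suc (length p)) x} allow)))
    (*-cong (letterWeight-positionWeight p x s within distinct)
            (wordWeight-valid (x ∷ p) s within distinct
              (cong₂ _∧_ (∧-trueʳ {notIn x p} fresh) (∧-trueʳ {allowed (suc (length p)) x} allow))))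
    where
    fresh : notIn x p ∧ freshAfter (x ∷ p) s ≡ true
    fresh = ∧-trueˡ {freshAfter p (x ∷ s)} ok
    allow : allowed (suc (length p)) x ∧ allAllowed (suc (length p)) s ≡ true
    allow = ∧-trueʳ {freshAfter p (x ∷ s)} ok
    if-true : ∀ {p} {y : Carrier} → p ≡ true → (if p then y else 0#) ≈ y
    if-true ≡.refl = refl

  productOver : (ℕ → Carrier) → List ℕ → Carrier
  productOver g = foldr (λ i y → g i * y) 1#

  productOver-* : ∀ g h xs → productOver g xs * productOver h xs ≈ productOver (λ i → g i * h i) xs
  productOver-* g h []       = *-identityˡ 1#
  productOver-* g h (x ∷ xs) = trans (interchange _ _ _ _) (*-congˡ (productOver-* g h xs))

  prodOver-choose : ∀ m p g → prodOver R m p g ≈ productOver (λ i → choose (p i) (g i)) (range m)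
  prodOver-choose m p g = go (range m)
    where
    go : ∀ xs → prodR R (map g (filterᵇ p xs)) ≈ productOver (λ i → choose (p i) (g i)) xs
    go []       = refl
    go (x ∷ xs) with p x
    ... | true  = *-congˡ (go xs)
    ... | false = trans (go xs) (sym (*-identityˡ _))

  weight-positionWeight : ∀ w → weight R a b c' d e f (length w) w ≈
    posFold (λ i _ y → positionWeight (length w) w i * y) 0 1# w
  weight-positionWeight w = trans
    (merge (prodOver-choose m isCval _) (merge (prodOver-choose m isCpeak _) (merge (prodOver-choose m isCdfall _)
      (merge (prodOver-choose m isCdrise _) (merge (prodOver-choose m isEvenfix _) (prodOver-choose m isOddfix _))))))
    (reflexive (foldr-range (λ i _ y → positionWeight m w i * y) 1# w))
    where
    m = length w
    open Stats m w
    merge : ∀ {x y g h} → x ≈ productOver g (range m) → y ≈ productOver h (range m) →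
            x * y ≈ productOver (λ i → g i * h i) (range m)
    merge x≈ y≈ = trans (*-cong x≈ y≈) (productOver-* _ _ (range m))

  wordWeight-weight : ∀ {m w} → length w ≡ m × All (Within m) w →
    (if allDistinct w then (if isD m w then weight R a b c' d e f m w else 0#) else 0#) ≈ wordWeight m [] w
  wordWeight-weight {m} {w} (≡.refl , within) = by-cases _ _ ≡.refl ≡.refl
    where
    valid≡ : ∀ {y z} → allDistinct w ≡ y → isD m w ≡ z → freshAfter [] w ∧ allAllowed 0 w ≡ y ∧ z
    valid≡ distinct isd = cong₂ _∧_ (≡.trans (≡.sym (allDistinct-freshAfter [] w)) distinct)
                                    (≡.trans (≡.sym (isD-allAllowed w)) isd)
    by-cases : ∀ y z → allDistinct w ≡ y → isD m w ≡ z →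
      (if y then (if z then weight R a b c' d e f m w else 0#) else 0#) ≈ wordWeight m [] w
    by-cases false z     distinct isd = sym (wordWeight-invalid m [] w (valid≡ distinct isd))
    by-cases true  false distinct isd = sym (wordWeight-invalid m [] w (valid≡ distinct isd))
    by-cases true  true  distinct isd =
      trans (weight-positionWeight w) (sym (wordWeight-valid [] w within distinct (valid≡ distinct isd)))

  -- The empty set is the only one of size `0`. This turns the initial state of the scan into a sum
  -- over sets of one size, as `sumSub-completions` requires.
  sumSub-empty : ∀ k o (F : Vec Bool k → Carrier) → sumSub k 0 F ≈ F (window k o (used []))
  sumSub-empty zero    o F = refl
  sumSub-empty (suc k) o F = sumSub-empty k (suc o) (F ∘ (false ∷_))

  Q-pathSum : ∀ n → Q R a b c' d e f n ≈ pathSum (double n) 0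
  Q-pathSum n = begin
    Q R a b c' d e f n
      ≈⟨ trans (sumOver-filterᵇ (isD m) wt (perms m)) (sumOver-filterᵇ allDistinct _ (allWords m m)) ⟩
    sumOver (λ w → if allDistinct w then (if isD m w then wt w else 0#) else 0#) (allWords m m)
      ≈⟨ sumOver-cong (All.map wordWeight-weight (allWords-within m m)) ⟩
    sumOver (wordWeight m []) (allWords m m)
      ≈⟨ sum-wordWeight m m [] ⟩
    extensions m m []
      ≈⟨ extensions-completions m (≡.trans (cong isEven (≡.sym (double≡2* n))) (isEven-double n)) m [] ≡.refl ⟩
    completions m (window m 0 (used [])) 0
      ≈⟨ sumSub-empty m 0 (λ S → completions m S 0) ⟨
    sumSub m 0 (λ S → completions m S 0)
      ≈⟨ sumSub-completions m 0 ⟩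
    pathSum m 0
      ≈⟨ reflexive (cong (λ m → pathSum m 0) (≡.sym (double≡2* n))) ⟩
    pathSum (double n) 0 ∎
    where
    m = 2 N.* n
    wt = weight R a b c' d e f m

  alpha-odd : ∀ h → alpha R a b c' d e f (suc (double h)) ≈ A (suc h) * B (suc h)
  alpha-odd h rewrite isEven-double h | half-double h = refl

  alpha-even : ∀ h → alpha R a b c' d e f (suc (suc (double h))) ≈ E (suc h) * F (suc h)
  alpha-even h rewrite isEven-suc-double h | half-suc-double h = refl

  Q-Tcoeff : ∀ n → Q R a b c' d e f n ≈ Tcoeff R (alpha R a b c' d e f) (delta R e f) n
  Q-Tcoeff n = trans (Q-pathSum n) (Contraction.pathSum-tfrac R A B E F (alpha R a b c' d e f) (delta R e f)
    -- `B 0` computes to `0#`. `C 0` and `D 0` are empty sums too, so `E 0 * F 0` is `e 0 * f 0`: at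
    -- height `0` a pair of level steps is a pair of fixed points, which is where `δ 1` comes from.
    refl alpha-odd alpha-even (sym (*-cong (+-identityʳ (e 0)) (+-identityʳ (f 0)))) (λ _ → refl) n)

theorem3p11 : {c ℓ : Level} (R : CommutativeRing c ℓ) →
    let open CommutativeRing R in
    (a b c' d : ℕ → ℕ → Carrier) (e f : ℕ → Carrier) (n : ℕ) →
    Q R a b c' d e f n ≈ Tcoeff R (alpha R a b c' d e f) (delta R e f) n
theorem3p11 R a b c' d e f = WeightSum.Q-Tcoeff R a b c' d e f
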